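{- Let $(V,\to,\Omega,\mathcal P)$ be a parity game. For all $v,w\in V$: $v$ and $w$ are governed stuttering bisimilar if and only if Duplicator wins the governed stuttering bisimulation game for position $(v,w)$, i.e. has a strategy that wins all plays starting in configuration $((v,w),\checkmark)$.
   Context: A parity game is a tuple $(V,\to,\Omega,\mathcal P)$ where $V$ is a finite set of vertices, $\to\subseteq V\times V$ is total (every vertex has at least one successor), $\Omega:V\to\mathbb N$ is a priority function, and $\mathcal P:V\to\{\Diamond,\Box\}$ assigns each vertex to player even ($\Diamond$) or odd ($\Box$). Write $v^\bullet=\{w\mid v\to w\}$. A memoryless strategy for player $i$ is a partial function $\sigma:V\to V$ defined only on vertices owned by $i$, with $v\to\sigma(v)$ whenever defined. It allows an infinite path $p=v_0v_1\dots$ iff $v_{j+1}=\sigma(v_j)$ whenever $\sigma(v_j)$ is defined. For $v\in V$, $U,T\subseteq V$: - $v\mapsto_{i,U}T$ iff there is a memoryless strategy $\sigma$ for $i$ such that every infinite path $p=v_0v_1\dots$ with $v_0=v$ allowed by $\sigma$ has some $n$ with $v_n\in T$ and $v_j\in U$ for all $j<n$; - $v\mapsto_{i,U}$ iff there is a memoryless strategy $\sigma$ for $i$ such that every infinite path $v_0v_1\dots$ with $v_0=v$ allowed by $\sigma$ has $v_j\in U$ for all $j$. For an equivalence relation $R$ on $V$, $[v]_R$ is the class of $v$ and $V_{/R}$ the set of classes. An equivalence relation $R\subseteq V\times V$ is a governed stuttering bisimulation iff $v\,R\,w$ implies: (a) $\Omega(v)=\Omega(w)$; (b) for all $\mathcal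 C\in V_{/R}\setminus\{[v]_R\}$, if $v$ has a successor in $\mathcal C$ then $w\mapsto_{\mathcal P(v),[w]_R}\mathcal C$; (c) for each player $i\in\{\Diamond,\Box\}$, $v\mapsto_{i,[v]_R}$ implies $w\mapsto_{i,[w]_R}$. Vertices $v,w$ are governed stuttering bisimilar iff some governed stuttering bisimulation $R$ has $v\,R\,w$. Governed stuttering bisimulation game: let $C=(\{0,1\}\times V)\cup\{\dagger,\checkmark\}$. Spoiler and Duplicator play in rounds on configurations in $(V\times V)\times C$. A round from $((v,w),c)$: 1. Spoiler chooses $(u_0,u_1)\in\{(v,w),(w,v)\}$. 2. Moves $t_0\in u_0^\bullet$ and $t_1\in u_1^\bullet$ are chosen as follows: - $\mathcal P(u_0)=\Diamond,\mathcal P(u_1)=\Diamond$: Spoiler chooses $t_0$, then Duplicator chooses $t_1$; - $\mathcal P(u_0)=\Diamond,\mathcal P(u_1)=\Box$: Spoiler chooses $t_0$, then Spoiler chooses $t_1$; - $\mathcal P(u_0)=\Box,\mathcal P(u_1)=\Diamond$: Duplicator chooses $t_1$, then Duplicator chooses $t_0$; - $\mathcal P(u_0)=\Box,\mathcal P(u_1)=\Box$: Spoiler chooses $t_1$, then Duplicator chooses $t_0$. 3. Duplicator selects the new configuration from $$\{((t_0,t_1),\checkmark),\ ((u_0,t_1),\gamma(c,(0,t_0),v,u_0)),\ ((t_0,u_1),\gamma(c,(1,t_1),w,u_1))\},$$ where $\gamma(c,c',u,t)$ equals: $c'$ if Spoiler played on $t$, $u=t$ and $c\in\{\dagger,\checkmark,c'\}$;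 $\checkmark$ if $u\neq t$, or Spoiler played on $t$ and $c\notin\{\dagger,\checkmark,c'\}$; and $\dagger$ otherwise. Here "Spoiler played on $t$" means that, in step 2, the move of the component in question (component $0$, i.e. $u_0$, in the second option; component $1$, i.e. $u_1$, in the third option) was chosen by Spoiler. An infinite play $((v_0,w_0),c_0),((v_1,w_1),c_1),\dots$ is won by Duplicator iff $\Omega(v_j)=\Omega(w_j)$ for all $j$ and $c_k=\checkmark$ for infinitely many $k$; otherwise it is won by Spoiler. -}

module Defs where

open import Level using (0ℓ)
open import Data.Bool using (Bool; true; false; if_then_else_; not; _∧_; _∨_)
open import Data.Fin using (Fin)
import Data.Fin.Properties as Fin
open import Data.Fin.Patterns using (0F; 1F)
open import Data.List using (List; []; _∷_; applyUpTo)
import Data.List.Membership.DecPropositional as DecMembership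
open import Data.Maybe using (Maybe; just)
open import Data.Nat using (ℕ; suc; _<_; _≤_)
open import Data.Product using (Σ-syntax; ∃; ∃-syntax; _×_; _,_; proj₁; proj₂)
open import Relation.Binary using (Rel; Decidable; DecidableEquality; IsEquivalence)
open import Relation.Binary.PropositionalEquality using (_≡_; refl)
open import Relation.Nullary using (¬_; yes; no; does)
open import Relation.Unary using (Pred; _∈_; _≐_)

data Player : Set where
  ◇ □ : Player

-- Vertices are the elements of Fin size. Decidability of the edge relation
-- makes it a subset of a finite set in the usual (classical) sense.
record ParityGame : Set₁ where
  infix 4 _⟶_ _⟶?_
  field
    size  : ℕ
    _⟶_   : Rel (Fin size) 0ℓ
    _⟶?_  : Decidable _⟶_
    total : ∀ v → ∃[ w ] v ⟶ w
    Ω     : Fin size → ℕ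
    𝒫     : Fin size → Player

  Vertex : Set
  Vertex = Fin size

module Bisimulation (G : ParityGame) where
  open ParityGame G

  record MemorylessStrategy (i : Player) : Set where
    field
      σ     : Vertex → Maybe Vertex
      owned : ∀ {v w} → σ v ≡ just w → 𝒫 v ≡ i
      legal : ∀ {v w} → σ v ≡ just w → v ⟶ w

  record InfinitePath (v : Vertex) : Set where
    field
      at    : ℕ → Vertex
      first : at 0 ≡ v
      step  : ∀ j → at j ⟶ at (suc j)

  Allows : ∀ {i v} → MemorylessStrategy i → InfinitePath v → Set
  Allows s p = ∀ j {w} → σ (at j) ≡ just w → at (suc j) ≡ w
    where
    open MemorylessStrategy s
    open InfinitePath p

  _↦⟨_,_⟩_ : Vertex → Player → Pred Vertex 0ℓ → Pred Vertex 0ℓ → Set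
  v ↦⟨ i , U ⟩ T =
    Σ[ s ∈ MemorylessStrategy i ] ((p : InfinitePath v) → Allows s p →
      let open InfinitePath p in
      ∃[ n ] at n ∈ T × (∀ j → j < n → at j ∈ U))

  _↦⟨_,_⟩ : Vertex → Player → Pred Vertex 0ℓ → Set
  v ↦⟨ i , U ⟩ =
    Σ[ s ∈ MemorylessStrategy i ] ((p : InfinitePath v) → Allows s p →
      let open InfinitePath p in
      ∀ j → at j ∈ U)

  [_]⟨_⟩ : Vertex → Rel Vertex 0ℓ → Pred Vertex 0ℓ
  [ v ]⟨ R ⟩ = λ w → R v w

  -- A class 𝒞 is given by a representative u, and 𝒞 ≠ [v] is expressed
  -- extensionally.
  record IsGovernedStutteringBisimulation (R : Rel Vertex 0ℓ) : Set where
    field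
      isEquivalence : IsEquivalence R
      priority : ∀ {v w} → R v w → Ω v ≡ Ω w
      transfer : ∀ {v w} → R v w →
                 ∀ u → ¬ ([ u ]⟨ R ⟩ ≐ [ v ]⟨ R ⟩) →
                 (∃[ t ] (v ⟶ t × t ∈ [ u ]⟨ R ⟩)) →
                 w ↦⟨ 𝒫 v , [ w ]⟨ R ⟩ ⟩ [ u ]⟨ R ⟩
      divergence : ∀ {v w} → R v w →
                   ∀ i → v ↦⟨ i , [ v ]⟨ R ⟩ ⟩ → w ↦⟨ i , [ w ]⟨ R ⟩ ⟩

  GovernedStutteringBisimilar : Vertex → Vertex → Set₁
  GovernedStutteringBisimilar v w =
    Σ[ R ∈ Rel Vertex 0ℓ ] (IsGovernedStutteringBisimulation R × R v w)

module BisimulationGame (G : ParityGame) where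
  open ParityGame G

  data Contestant : Set where
    Spoiler Duplicator : Contestant

  isSpoiler : Contestant → Bool
  isSpoiler Spoiler    = true
  isSpoiler Duplicator = false

  Component : Set
  Component = Fin 2

  data Challenge : Set where
    ⟪_,_⟫ : Component → Vertex → Challenge
    †     : Challenge
    ✓     : Challenge

  _≟C_ : DecidableEquality Challenge
  ⟪ k , v ⟫ ≟C ⟪ l , w ⟫ with k Fin.≟ l | v Fin.≟ w
  ... | yes refl | yes refl = yes refl
  ... | no k≢l   | _        = no λ { refl → k≢l refl }
  ... | yes _    | no v≢w   = no λ { refl → v≢w refl }
  ⟪ _ , _ ⟫ ≟C †         = no λ ()
  ⟪ _ , _ ⟫ ≟C ✓         = no λ ()
  †         ≟C ⟪ _ , _ ⟫ = no λ ()
  †         ≟C †         = yes refl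
  †         ≟C ✓         = no λ ()
  ✓         ≟C ⟪ _ , _ ⟫ = no λ ()
  ✓         ≟C †         = no λ ()
  ✓         ≟C ✓         = yes refl

  open DecMembership _≟C_ using (_∈?_)

  Configuration : Set
  Configuration = (Vertex × Vertex) × Challenge

  -- `mover` is the contestant who played on t.
  γ : (mover : Contestant) → Challenge → Challenge → Vertex → Vertex → Challenge
  γ mover c c′ u t =
    if spoilerPlayed ∧ same ∧ compatible then c′
    else if not same ∨ (spoilerPlayed ∧ not compatible) then ✓
    else †
    where
    spoilerPlayed = isSpoiler mover
    same          = does (u Fin.≟ t)
    compatible    = does (c ∈? († ∷ ✓ ∷ c′ ∷ []))

  -- For the owners of u₀ and u₁: who moves first and on which component, and
  -- who moves second and on which component.
  schedule : Player → Player → (Contestant × Component) × (Contestant × Component)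
  schedule ◇ ◇ = (Spoiler    , 0F) , (Duplicator , 1F)
  schedule ◇ □ = (Spoiler    , 0F) , (Spoiler    , 1F)
  schedule □ ◇ = (Duplicator , 1F) , (Duplicator , 0F)
  schedule □ □ = (Spoiler    , 1F) , (Duplicator , 0F)

  component : Vertex × Vertex → Component → Vertex
  component (u₀ , u₁) 0F = u₀
  component (u₀ , u₁) 1F = u₁

  turn₁ turn₂ : Vertex × Vertex → Contestant × Component
  turn₁ (u₀ , u₁) = proj₁ (schedule (𝒫 u₀) (𝒫 u₁))
  turn₂ (u₀ , u₁) = proj₂ (schedule (𝒫 u₀) (𝒫 u₁))

  -- The pair (t₀ , t₁), given the component moved first, the vertex chosen on
  -- it, and the vertex chosen on the other component.
  arrange : Component → Vertex → Vertex → Vertex × Vertex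
  arrange 0F t t′ = t , t′
  arrange 1F t t′ = t′ , t

  chooser : Vertex × Vertex → Component → Contestant
  chooser u k = if does (proj₂ (turn₁ u) Fin.≟ k) then proj₁ (turn₁ u) else proj₁ (turn₂ u)

  -- A round from κ runs through four positions: start κ, where (u₀ , u₁) is
  -- chosen; move₁ and move₂, where t₀ and t₁ are chosen in the order given by
  -- schedule; and select, where the next configuration is chosen.
  data Position : Set where
    start  : (κ : Configuration) → Position
    move₁  : (κ : Configuration) (u : Vertex × Vertex) → Position
    move₂  : (κ : Configuration) (u : Vertex × Vertex) (t : Vertex) → Position
    select : (κ : Configuration) (u t : Vertex × Vertex) → Position

  toMove : Position → Contestant
  toMove (start _)      = Spoiler
  toMove (move₁ _ u)    = proj₁ (turn₁ u)
  toMove (move₂ _ u _)  = proj₁ (turn₂ u)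
  toMove (select _ _ _) = Duplicator

  infix 4 _⇒_
  data _⇒_ : Position → Position → Set where
    keep : ∀ {v w c} → start ((v , w) , c) ⇒ move₁ ((v , w) , c) (v , w)
    swap : ∀ {v w c} → start ((v , w) , c) ⇒ move₁ ((v , w) , c) (w , v)
    choose₁ : ∀ {κ u t} → component u (proj₂ (turn₁ u)) ⟶ t →
              move₁ κ u ⇒ move₂ κ u t
    choose₂ : ∀ {κ u t t′} → component u (proj₂ (turn₂ u)) ⟶ t′ →
              move₂ κ u t ⇒ select κ u (arrange (proj₂ (turn₁ u)) t t′)
    advance : ∀ {κ u t} → select κ u t ⇒ start (t , ✓)
    stay₀ : ∀ {v w c u₀ u₁ t₀ t₁} →
            select ((v , w) , c) (u₀ , u₁) (t₀ , t₁) ⇒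
            start ((u₀ , t₁) , γ (chooser (u₀ , u₁) 0F) c ⟪ 0F , t₀ ⟫ v u₀)
    stay₁ : ∀ {v w c u₀ u₁ t₀ t₁} →
            select ((v , w) , c) (u₀ , u₁) (t₀ , t₁) ⇒
            start ((t₀ , u₁) , γ (chooser (u₀ , u₁) 1F) c ⟪ 1F , t₁ ⟫ w u₁)

  record Play (κ : Configuration) : Set where
    field
      at    : ℕ → Position
      first : at 0 ≡ start κ
      step  : ∀ j → at j ⇒ at (suc j)

  -- A strategy sees the whole history: the earlier positions (oldest first)
  -- and the current one.
  DuplicatorStrategy : Set
  DuplicatorStrategy =
    (history : List Position) (p : Position) → toMove p ≡ Duplicator → ∃ (p ⇒_)

  Follows : ∀ {κ} → Play κ → DuplicatorStrategy → Set
  Follows π s = ∀ j (d : toMove (at j) ≡ Duplicator) →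
                at (suc j) ≡ proj₁ (s (applyUpTo at j) (at j) d)
    where open Play π

  -- The configurations of a play are those it visits at `start` positions.
  record WonByDuplicator {κ} (π : Play κ) : Set where
    open Play π
    field
      priorities : ∀ j {v w c} → at j ≡ start ((v , w) , c) → Ω v ≡ Ω w
      rewarded   : ∀ m → ∃[ k ] (m ≤ k × (∃[ vw ] at k ≡ start (vw , ✓)))

  DuplicatorWins : Vertex → Vertex → Set
  DuplicatorWins v w =
    Σ[ s ∈ DuplicatorStrategy ]
      ((π : Play ((v , w) , ✓)) → Follows π s → WonByDuplicator π)

{-# OPTIONS --safe #-}

-- In a round, Spoiler in effect is player ◇ at u₀ and player □ at u₁, and Duplicator the opposite
-- player at each of them. Bisimilar vertices u₀ and u₁ of a class 𝒞 can be matched in this round,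
-- or one of them leaves 𝒞 while the other does not. In the latter case Duplicator waits at the
-- leaving vertex and moves the other one along an attractor strategy, either to the class that
-- Spoiler has chosen (by transfer) or merely out of 𝒞 (by divergence). The attractor rank shows
-- that she earns a reward eventually.
--
-- Conversely, suppose that Duplicator wins from (x , y) and let ~ be the equivalence closure of
-- such pairs. If player i can force x to T through U, for unions U and T of classes of ~, but
-- cannot do so for y, then Spoiler plays i's attractor strategy at x and the opponent's avoiding
-- strategy at y. The play either separates the pair by T or U, although ~ is invariant along it,
-- or from some point on Duplicator lets x wait and earns no reward. Hence forcing transfers along
-- ~, which gives transfer directly and divergence by determinacy.
--
-- Both conditions of a bisimulation are decidable by the computation of attractors, and there are
-- only finitely many relations on the vertices. Bisimilarity is therefore decidable, which makes
-- these classical arguments constructive.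
module Submission where

open import Defs
open import Level using (0ℓ)
open import Axiom.UniquenessOfIdentityProofs.WithK using (uip)
open import Data.Bool using (Bool; true; false; if_then_else_)
open import Data.Empty using (⊥; ⊥-elim)
open import Data.Fin using (Fin; toℕ; combine; remQuot)
open import Data.Fin.Patterns using (0F; 1F)
import Data.Fin.Properties as Fin
open import Data.List using (List; []; _∷_; applyUpTo)
open import Data.List.Membership.Propositional using () renaming (_∈_ to _∈ₗ_)
import Data.List.Membership.DecPropositional as DecMembership
open import Data.List.Relation.Unary.Any using (here; there)
open import Data.Fin.Subset as Subset using (Subset)
open import Data.Fin.Subset.Properties as Subset using (anySubset?)
open import Data.Maybe using (Maybe; just; nothing)
open import Data.Nat using (ℕ; zero; suc; _*_; _<_; _≤_; z≤n; s≤s)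
open import Data.Nat.Induction using (<-wellFounded)
import Data.Nat.Properties as ℕ
open import Data.Product using (Σ-syntax; ∃; ∃-syntax; _×_; _,_; proj₁; proj₂; uncurry)
open import Data.Product.Relation.Binary.Lex.Strict using (×-Lex; ×-decidable; ×-wellFounded)
open import Data.Sum using (_⊎_; inj₁; inj₂; [_,_]′; map₂) renaming (swap to swap⊎)
open import Data.Unit using (⊤)
open import Data.Vec using (tabulate; lookup)
open import Data.Vec.Properties using (lookup∘tabulate; lookup⇒[]=; []=⇒lookup)
open import Effect.Monad using (RawMonad)
open import Induction.WellFounded using (Acc; acc)
open import Function using (_∘_; id; case_of_)
open import Function.Bundles using (_⇔_; mk⇔)
open import Relation.Binary using (Rel; IsEquivalence; DecidableEquality)
import Relation.Binary as Binary
open import Relation.Binary.PropositionalEquality using (_≡_; _≢_; refl; sym; trans; cong; subst)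
open import Relation.Nullary using (¬_; Dec; yes; no; does; contradiction)
open import Relation.Nullary.Decidable using (_×-dec_; _⊎-dec_; _→-dec_; ¬?; map′)
open import Relation.Nullary.Decidable using (dec-true; dec-false; does-⇔; decidable-stable; ¬¬-excluded-middle)
open import Relation.Nullary.Negation using (¬¬-Monad)
open import Relation.Unary using (Pred; Decidable; _⊆_; ∁; U)
open import Relation.Unary.Properties using (U?; ∁?)

-- The two players.

opp : Player → Player
opp ◇ = □
opp □ = ◇

_≟P_ : DecidableEquality Player
◇ ≟P ◇ = yes refl
◇ ≟P □ = no λ ()
□ ≟P ◇ = no λ ()
□ ≟P □ = yes refl

opp-involutive : ∀ i → opp (opp i) ≡ i
opp-involutive ◇ = refl
opp-involutive □ = refl

opp≢ : ∀ i → opp i ≢ i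
opp≢ ◇ ()
opp≢ □ ()

≢⇒≡opp : ∀ {i j} → j ≢ i → j ≡ opp i
≢⇒≡opp {◇} {◇} j≢i = contradiction refl j≢i
≢⇒≡opp {◇} {□} _   = refl
≢⇒≡opp {□} {◇} _   = refl
≢⇒≡opp {□} {□} j≢i = contradiction refl j≢i

-- One-step forcing in a graph with owned positions.

module ControllablePredecessor
  {A O : Set} (_↝_ : Rel A 0ℓ) (owner : A → O) (_≟_ : DecidableEquality O) where

  -- The controllable predecessor. It serves both for vertices owned by players and for game
  -- positions owned by contestants.
  Cpre : O → Pred A 0ℓ → Pred A 0ℓ
  Cpre o X a = (owner a ≡ o → ∃[ b ] (a ↝ b × X b)) × (owner a ≢ o → ∀ b → a ↝ b → X b)

  Cpre-map : ∀ {o X Y a} → (∀ {b} → a ↝ b → X b → Y b) → Cpre o X a → Cpre o Y a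
  Cpre-map f (own , other) =
    (λ e → let b , s , x = own e in b , s , f s x) , λ ne b s → f s (other ne b s)

  module _ (∃↝? : ∀ {X : Pred A 0ℓ} → Decidable X → ∀ a → Dec (∃[ b ] (a ↝ b × X b))) where

    ∀↝? : ∀ {X : Pred A 0ℓ} → Decidable X → ∀ a → Dec (∀ b → a ↝ b → X b)
    ∀↝? X? a =
      map′ (λ ¬∃ b s → decidable-stable (X? b) λ ¬x → ¬∃ (b , s , ¬x))
           (λ { ∀x (b , s , ¬x) → ¬x (∀x b s) })
           (¬? (∃↝? (¬? ∘ X?) a))

    Cpre? : ∀ o {X} → Decidable X → Decidable (Cpre o X)
    Cpre? o X? a =
      ((owner a ≟ o) →-dec ∃↝? X? a) ×-dec (¬? (owner a ≟ o) →-dec ∀↝? X? a)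

-- Increasing chains of subsets of a finite set.

module IncreasingChain
  {n : ℕ} (L : ℕ → Pred (Fin n) 0ℓ) (L? : ∀ k → Decidable (L k))
  (increasing : ∀ k → L k ⊆ L (suc k)) where

  L-mono : ∀ {j k} → j ≤ k → L j ⊆ L k
  L-mono {k = zero}  z≤n x = x
  L-mono {k = suc k} j≤k x with ℕ.m≤n⇒m<n∨m≡n j≤k
  ... | inj₁ (s≤s j≤k′) = increasing k (L-mono j≤k′ x)
  ... | inj₂ refl       = x

  abstract
    -- Otherwise each of n + 1 levels would add an element of its own.
    stationary : ∃[ k ] L (suc k) ⊆ L k
    stationary with Fin.any? {suc n} (λ k → Fin.all? (λ v → L? (suc (toℕ k)) v →-dec L? (toℕ k) v))
    ... | yes (k , sub) = toℕ k , sub _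
    ... | no ¬stat = contradiction (Fin.pigeonhole (ℕ.≤-refl {suc n}) (proj₁ ∘ new)) noCollision
      where
      new : ∀ (k : Fin (suc n)) → ∃[ v ] ¬ (L (suc (toℕ k)) v → L (toℕ k) v)
      new k = Fin.¬∀⟶∃¬ n _ (λ v → L? (suc (toℕ k)) v →-dec L? (toℕ k) v) (¬stat ∘ (k ,_))
      noCollision : ¬ (∃[ i ] ∃[ j ] (toℕ i < toℕ j × proj₁ (new i) ≡ proj₁ (new j)))
      noCollision (i , j , i<j , e) = proj₂ (new j) λ _ →
        subst (L (toℕ j)) e (L-mono i<j (decidable-stable (L? (suc (toℕ i)) (proj₁ (new i)))
          λ ¬x → proj₂ (new i) (⊥-elim ∘ ¬x)))

  -- The least level containing v, and k if none below k does.
  rankBelow : ℕ → Fin n → ℕ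
  rankBelow zero    v = zero
  rankBelow (suc k) v = if does (L? k v) then rankBelow k v else suc k

  rankBelow-∈ : ∀ k {v} → L k v → L (rankBelow k v) v
  rankBelow-∈ zero        x = x
  rankBelow-∈ (suc k) {v} x with L? k v
  ... | yes y = rankBelow-∈ k y
  ... | no  _ = x

  rankBelow-least : ∀ k {j v} → L j v → rankBelow k v ≤ j
  rankBelow-least zero            x = z≤n
  rankBelow-least (suc k) {j} {v} x with L? k v
  ... | yes _ = rankBelow-least k x
  ... | no ¬y = ℕ.≰⇒> λ j≤k → ¬y (L-mono j≤k x)

-- Attractors, and determinacy of reachability and safety.

module Attraction (G : ParityGame) where
  open ParityGame G
  open Bisimulation G
  open ControllablePredecessor _⟶_ 𝒫 _≟P_ public

  ∃⟶? : ∀ {X : Pred Vertex 0ℓ} → Decidable X → ∀ v → Dec (∃[ t ] (v ⟶ t × X t))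
  ∃⟶? X? v = Fin.any? λ t → (v ⟶? t) ×-dec X? t

  -- Negation exchanges "some successor" and "every successor", and there are only two players;
  -- decidability of `X` yields the witness.
  Cpre-dual : ∀ i {X : Pred Vertex 0ℓ} {v} → Decidable X → ¬ Cpre i X v → Cpre (opp i) (∁ X) v
  Cpre-dual i {X} {v} X? ¬c = mine , other
    where
    mine : 𝒫 v ≡ opp i → ∃[ t ] (v ⟶ t × ¬ X t)
    mine e with ∃⟶? (¬? ∘ X?) v
    ... | yes w = w
    ... | no ¬w = contradiction
      ((λ e′ → contradiction (trans (sym e) e′) (opp≢ i)) ,
       (λ _ t s → decidable-stable (X? t) λ ¬x → ¬w (t , s , ¬x))) ¬c
    other : 𝒫 v ≢ opp i → ∀ t → v ⟶ t → ¬ X t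
    other ne t s x = ¬c ((λ _ → t , s , x) , λ ne′ → contradiction (≢⇒≡opp ne′) ne)

  module Attractor (i : Player) {U T : Pred Vertex 0ℓ} (U? : Decidable U) (T? : Decidable T) where

    Level : ℕ → Pred Vertex 0ℓ
    Level zero    v = T v
    Level (suc k) v = Level k v ⊎ (U v × Cpre i (Level k) v)

    Level? : ∀ k → Decidable (Level k)
    Level? zero    v = T? v
    Level? (suc k) v = Level? k v ⊎-dec (U? v ×-dec Cpre? ∃⟶? i (Level? k) v)

    open IncreasingChain Level Level? (λ _ → inj₁)

    height : ℕ
    height = proj₁ stationary

    Attr : Pred Vertex 0ℓ
    Attr = Level height

    Attr? : Decidable Attr
    Attr? = Level? height

    rank : Vertex → ℕ
    rank = rankBelow height

    Level⊆Attr : ∀ k → Level k ⊆ Attr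
    Level⊆Attr zero    x = L-mono {0} {height} z≤n x
    Level⊆Attr (suc k) (inj₁ x)       = Level⊆Attr k x
    Level⊆Attr (suc k) (inj₂ (u , c)) =
      proj₂ stationary (inj₂ (u , Cpre-map (λ _ → Level⊆Attr k) c))

    T⊆Attr : T ⊆ Attr
    T⊆Attr = Level⊆Attr 0

    Attr-closed : ∀ {v} → U v → Cpre i Attr v → Attr v
    Attr-closed u c = Level⊆Attr (suc height) (inj₂ (u , c))

    Descends : Rel Vertex 0ℓ
    Descends v t = Attr t × rank t < rank v

    Descends? : ∀ v → Decidable (Descends v)
    Descends? v t = Attr? t ×-dec (rank t ℕ.<? rank v)

    -- The rank is the least level containing `v`, so `v` enters that level by the predecessor
    -- clause, and the successors in question lie in an earlier level.
    descend : ∀ {v} → Attr v → ¬ T v → U v × Cpre i (Descends v) v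
    descend {v} a ¬t with rank v in eq | rankBelow-∈ height a
    ... | zero  | t = contradiction t ¬t
    ... | suc j | inj₁ x =
      contradiction (subst (_≤ j) eq (rankBelow-least height x)) ℕ.1+n≰n
    ... | suc j | inj₂ (u , c) =
      u , Cpre-map (λ _ x → Level⊆Attr j x , s≤s (rankBelow-least height x)) c

    reaches : (f : ℕ → Vertex) →
              (∀ j → Cpre i (Descends (f j)) (f j) → Descends (f j) (f (suc j))) →
              Attr (f 0) → ∃[ n ] (T (f n) × (∀ j → j < n → U (f j)))
    reaches f desc a = go (suc (rank (f 0))) f desc a ℕ.≤-refl
      where
      go : ∀ r (f : ℕ → Vertex) →
           (∀ j → Cpre i (Descends (f j)) (f j) → Descends (f j) (f (suc j))) →
           Attr (f 0) → rank (f 0) < r → ∃[ n ] (T (f n) × (∀ j → j < n → U (f j)))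
      go (suc r) f desc a (s≤s le) with T? (f 0)
      ... | yes t = 0 , t , λ _ ()
      ... | no ¬t with descend a ¬t
      ...   | u , c with desc 0 c
      ...     | a′ , lt with go r (f ∘ suc) (desc ∘ suc) a′ (ℕ.<-≤-trans lt le)
      ...       | n , t , us = suc n , t , λ { zero _ → u ; (suc j) (s≤s j<n) → us j j<n }

    ∉Attr⇒∉T : ∀ {v} → ¬ Attr v → ¬ T v
    ∉Attr⇒∉T ¬a t = ¬a (T⊆Attr t)

    ∉Attr-step : ∀ {v} → ¬ Attr v → U v → Cpre (opp i) (∁ Attr) v
    ∉Attr-step ¬a u = Cpre-dual i Attr? (¬a ∘ Attr-closed u)

  open Attractor public using (Attr; Attr?)

  module _ (i : Player) {X : Rel Vertex 0ℓ} (X? : ∀ v → Decidable (X v)) where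
    private
      Choice : Vertex → Set
      Choice v = 𝒫 v ≡ i × ∃[ t ] (v ⟶ t × X v t)

      choice? : ∀ v → Dec (Choice v)
      choice? v = (𝒫 v ≟P i) ×-dec ∃⟶? (X? v) v

      pick : ∀ {v} → Dec (Choice v) → Maybe Vertex
      pick (yes (_ , t , _)) = just t
      pick (no _)            = nothing

      pick-just : ∀ {v w} (d : Dec (Choice v)) → pick d ≡ just w → 𝒫 v ≡ i × v ⟶ w × X v w
      pick-just (yes (e , _ , s , x)) refl = e , s , x

      pick-yes : ∀ {v} (d : Dec (Choice v)) → Choice v → ∃[ w ] pick d ≡ just w
      pick-yes (yes (_ , t , _)) _ = t , refl
      pick-yes (no ¬c)           c = contradiction c ¬c

    steer : MemorylessStrategy i
    steer = record
      { σ     = pick ∘ choice?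
      ; owned = proj₁ ∘ pick-just (choice? _)
      ; legal = proj₁ ∘ proj₂ ∘ pick-just (choice? _)
      }

    steer-obeys : ∀ {v} (p : InfinitePath v) → Allows steer p → let open InfinitePath p in
                  ∀ j → Cpre i (X (at j)) (at j) → X (at j) (at (suc j))
    steer-obeys p allowed j c with 𝒫 (InfinitePath.at p j) ≟P i
    ... | no ne = proj₂ c ne _ (InfinitePath.step p j)
    ... | yes e with pick-yes (choice? _) (e , proj₁ c e)
    ...   | w , eq = subst (X _) (sym (allowed j eq))
                       (proj₂ (proj₂ (pick-just (choice? _) eq)))

    -- The strategy `s` binds only vertices of `j`, where forcing by `i` covers every successor;
    -- elsewhere the path is free to take an `X`-successor.
    counterplay : ∀ {j} → j ≢ i → (s : MemorylessStrategy j) (v : Vertex) →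
                  Σ[ p ∈ InfinitePath v ] (Allows s p × let open InfinitePath p in
                    ∀ j → Cpre i (X (at j)) (at j) → X (at j) (at (suc j)))
    counterplay j≢i s v =
      record { at = at ; first = refl ; step = λ j → proj₁ (proj₂ (next (at j))) } ,
      (λ j → proj₁ (proj₂ (proj₂ (next (at j))))) ,
      (λ j → proj₂ (proj₂ (proj₂ (next (at j)))))
      where
      open MemorylessStrategy s
      next : ∀ v → ∃[ t ] (v ⟶ t × (∀ {w} → σ v ≡ just w → t ≡ w) × (Cpre i (X v) v → X v t))
      next v with σ v in eq
      ... | just t = t , legal eq , (λ { refl → refl }) ,
                     λ c → proj₂ c (λ e → j≢i (trans (sym (owned eq)) e)) t (legal eq)
      ... | nothing with ∃⟶? (X? v) v
      ...   | yes (t , e , x) = t , e , (λ ()) , λ _ → x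
      -- If `i` can force `X` from `v`, then `v` is not owned by `i`, so any successor will do.
      ...   | no ¬∃ = proj₁ (total v) , proj₂ (total v) , (λ ()) , λ c →
                      proj₂ c (¬∃ ∘ proj₁ c) _ (proj₂ (total v))
      at : ℕ → Vertex
      at zero    = v
      at (suc j) = proj₁ (next (at j))

  ↦-mono : ∀ {v i} {U U′ T : Pred Vertex 0ℓ} → U ⊆ U′ → v ↦⟨ i , U ⟩ T → v ↦⟨ i , U′ ⟩ T
  ↦-mono sub (s , f) = s , λ p a → let n , t , us = f p a in n , t , λ j j<n → sub (us j j<n)

  ↦∞-mono : ∀ {v i} {U U′ : Pred Vertex 0ℓ} → U ⊆ U′ → v ↦⟨ i , U ⟩ → v ↦⟨ i , U′ ⟩
  ↦∞-mono sub (s , f) = s , λ p a j → sub (f p a j)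

  module _ {i : Player} {U T : Pred Vertex 0ℓ} (U? : Decidable U) (T? : Decidable T) where
    private module A = Attractor i U? T?

    Attr⇒↦ : ∀ {v} → Attr i U? T? v → v ↦⟨ i , U ⟩ T
    Attr⇒↦ a = steer i A.Descends? , λ p allowed →
      A.reaches (InfinitePath.at p) (steer-obeys i A.Descends? p allowed)
        (subst A.Attr (sym (InfinitePath.first p)) a)

    -- Outside the attractor the opponent can avoid it for as long as the path remains in `U`, so
    -- some path allowed by `s` would fail to reach `T` through `U`.
    ↦⇒Attr : ∀ {v} → v ↦⟨ i , U ⟩ T → Attr i U? T? v
    ↦⇒Attr {v} (s , f) = decidable-stable (A.Attr? v) λ ¬a →
      let p , allowed , avoid =
            counterplay (opp i) {λ _ → ∁ A.Attr} (λ _ → ¬? ∘ A.Attr?) (opp≢ i ∘ sym) s v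
          n , t , us = f p allowed
      in A.∉Attr⇒∉T (stay p avoid ¬a us n ℕ.≤-refl) t
      where
      stay : ∀ {n} (p : InfinitePath v) → let open InfinitePath p in
             (∀ j → Cpre (opp i) (∁ A.Attr) (at j) → ¬ A.Attr (at (suc j))) →
             ¬ A.Attr v → (∀ j → j < n → U (at j)) → ∀ j → j ≤ n → ¬ A.Attr (at j)
      stay p avoid ¬a us zero    _   = subst (¬_ ∘ A.Attr) (sym (InfinitePath.first p)) ¬a
      stay p avoid ¬a us (suc j) j<n =
        avoid j (A.∉Attr-step (stay p avoid ¬a us j (ℕ.<⇒≤ j<n)) (us j j<n))

    ↦? : ∀ v → Dec (v ↦⟨ i , U ⟩ T)
    ↦? v = map′ Attr⇒↦ ↦⇒Attr (A.Attr? v)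

  module _ {i : Player} {V : Pred Vertex 0ℓ} (V? : Decidable V) where
    private module A = Attractor (opp i) {U} U? (∁? V?)

    -- The complement of the opponent's escape attractor lies in `V`, and `i` can remain in it. Here
    -- `U` is the universal predicate: the escape may pass through any vertex.
    ∉Escape⇒↦∞ : ∀ {v} → ¬ Attr (opp i) U? (∁? V?) v → v ↦⟨ i , V ⟩
    ∉Escape⇒↦∞ {v} ¬a = steer i {λ _ → ∁ A.Attr} X? , λ p allowed j →
      decidable-stable (V? _) (A.∉Attr⇒∉T (stay p allowed j))
      where
      X? : ∀ v → Decidable (∁ A.Attr)
      X? _ = ¬? ∘ A.Attr?
      stay : (p : InfinitePath v) → Allows (steer i X?) p → ∀ j → ¬ A.Attr (InfinitePath.at p j)
      stay p allowed zero    = subst (¬_ ∘ A.Attr) (sym (InfinitePath.first p)) ¬a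
      stay p allowed (suc j) = steer-obeys i X? p allowed j
        (subst (λ k → Cpre k (∁ A.Attr) _) (opp-involutive i) (A.∉Attr-step (stay p allowed j) _))

    ↦∞⇒∉Escape : ∀ {v} → v ↦⟨ i , V ⟩ → ¬ Attr (opp i) U? (∁? V?) v
    ↦∞⇒∉Escape {v} (s , f) a =
      let p , allowed , desc = counterplay (opp i) A.Descends? (opp≢ i ∘ sym) s v
          n , ¬v , _ = A.reaches (InfinitePath.at p) desc
                         (subst A.Attr (sym (InfinitePath.first p)) a)
      in ¬v (f p allowed n)

    ↦∞? : ∀ v → Dec (v ↦⟨ i , V ⟩)
    ↦∞? v = map′ ∉Escape⇒↦∞ ↦∞⇒∉Escape (¬? (A.Attr? v))

-- Rounds, challenges and winning positions of the bisimulation game.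

module Rounds (G : ParityGame) where
  open ParityGame G
  open BisimulationGame G
  open Attraction G
  open DecMembership _≟C_ using (_∈?_)

  _≟Con_ : DecidableEquality Contestant
  Spoiler    ≟Con Spoiler    = yes refl
  Spoiler    ≟Con Duplicator = no λ ()
  Duplicator ≟Con Spoiler    = no λ ()
  Duplicator ≟Con Duplicator = yes refl

  ≢Spoiler : ∀ {c} → c ≢ Spoiler → c ≡ Duplicator
  ≢Spoiler {Spoiler}    ne = contradiction refl ne
  ≢Spoiler {Duplicator} ne = refl

  open ControllablePredecessor _⇒_ toMove _≟Con_ public
    renaming (Cpre to Ctrl; Cpre-map to Ctrl-map; Cpre? to Ctrl?; ∀↝? to ∀⇒?)

  AtStart : Pred Configuration 0ℓ → Pred Position 0ℓ
  AtStart P (start κ)      = P κ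
  AtStart P (move₁ _ _)    = ⊥
  AtStart P (move₂ _ _ _)  = ⊥
  AtStart P (select _ _ _) = ⊥

  AtStart? : ∀ {P} → Decidable P → Decidable (AtStart P)
  AtStart? P? (start κ)      = P? κ
  AtStart? P? (move₁ _ _)    = no λ ()
  AtStart? P? (move₂ _ _ _)  = no λ ()
  AtStart? P? (select _ _ _) = no λ ()

  ∃⇒? : ∀ {X : Pred Position 0ℓ} → Decidable X → ∀ p → Dec (∃[ q ] (p ⇒ q × X q))
  ∃⇒? X? (start κ@((v , w) , c)) =
    map′ [ (λ x → _ , keep , x) , (λ x → _ , swap , x) ]′
         (λ { (_ , keep , x) → inj₁ x ; (_ , swap , x) → inj₂ x })
         (X? (move₁ κ (v , w)) ⊎-dec X? (move₁ κ (w , v)))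
  ∃⇒? X? (move₁ κ u) =
    map′ (λ (t , e , x) → _ , choose₁ e , x)
         (λ { (_ , choose₁ e , x) → _ , e , x })
         (Fin.any? λ t → (component u (proj₂ (turn₁ u)) ⟶? t) ×-dec X? (move₂ κ u t))
  ∃⇒? X? (move₂ κ u t) =
    map′ (λ (t′ , e , x) → _ , choose₂ e , x)
         (λ { (_ , choose₂ e , x) → _ , e , x })
         (Fin.any? λ t′ → (component u (proj₂ (turn₂ u)) ⟶? t′)
                            ×-dec X? (select κ u (arrange (proj₂ (turn₁ u)) t t′)))
  ∃⇒? X? (select κ u t) =
    map′ [ (λ x → _ , advance , x) , [ (λ x → _ , stay₀ , x) , (λ x → _ , stay₁ , x) ]′ ]′
         (λ { (_ , advance , x) → inj₁ x
            ; (_ , stay₀ , x) → inj₂ (inj₁ x)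
            ; (_ , stay₁ , x) → inj₂ (inj₂ x) })
         (X? _ ⊎-dec (X? _ ⊎-dec X? _))

  ⇒-total : ∀ p → ∃ (p ⇒_)
  ⇒-total (start _)      = _ , keep
  ⇒-total (move₁ _ u)    = _ , choose₁ (proj₂ (total _))
  ⇒-total (move₂ _ u _)  = _ , choose₂ (proj₂ (total _))
  ⇒-total (select _ _ _) = _ , advance

  Choice : Contestant → Contestant → Vertex → Pred Vertex 0ℓ → Set
  Choice o c v Y = (c ≡ o → ∃[ t ] (v ⟶ t × Y t)) × (c ≢ o → ∀ t → v ⟶ t → Y t)

  moves : ∀ {o X κ u a b} → 𝒫 (proj₁ u) ≡ a → 𝒫 (proj₂ u) ≡ b →
          (let (c₁ , k₁) , (c₂ , k₂) = schedule a b) →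
          Choice o c₁ (component u k₁) (λ t → Choice o c₂ (component u k₂) λ t′ →
            X (select κ u (arrange k₁ t t′))) →
          Ctrl o (Ctrl o X) (move₁ κ u)
  moves refl refl (own , other) =
    (λ e → let t , s , x = own e in _ , choose₁ s , second x) ,
    (λ { ne _ (choose₁ s) → second (other ne _ s) })
    where
    second : ∀ {o X κ u t} →
             Choice o (proj₁ (turn₂ u)) (component u (proj₂ (turn₂ u)))
               (λ t′ → X (select κ u (arrange (proj₂ (turn₁ u)) t t′))) →
             Ctrl o X (move₂ κ u t)
    second (own , other) =
      (λ e → let t , s , x = own e in _ , choose₂ s , x) ,
      (λ { ne _ (choose₂ s) → other ne _ s })

  -- Spoiler controls the moves of player i on component side i.
  side : Player → Component
  side ◇ = 0F
  side □ = 1F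

  -- Placing `x` on the side of `i` merges the arguments for the two components into one.
  pair : Player → Vertex → Vertex → Vertex × Vertex
  pair i = arrange (side i)

  afterStay : Player → Vertex × Vertex → Challenge → Vertex → Vertex → Vertex → Challenge
  afterStay i vw c x y t = γ (chooser (pair i x y) (side i)) c ⟪ side i , t ⟫ (component vw (side i)) x

  stay : ∀ i {vw c x y tx ty} →
         select (vw , c) (pair i x y) (pair i tx ty) ⇒ start (pair i x ty , afterStay i vw c x y tx)
  stay ◇ = stay₀
  stay □ = stay₁

  select⇒ : ∀ i {vw c x y tx ty q} → select (vw , c) (pair i x y) (pair i tx ty) ⇒ q →
            q ≡ start (pair i tx ty , ✓) ⊎
            q ≡ start (pair i x ty , afterStay i vw c x y tx) ⊎
            ∃[ c′ ] q ≡ start (pair i tx y , c′)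
  select⇒ ◇ advance = inj₁ refl
  select⇒ ◇ stay₀   = inj₂ (inj₁ refl)
  select⇒ ◇ stay₁   = inj₂ (inj₂ (_ , refl))
  select⇒ □ advance = inj₁ refl
  select⇒ □ stay₀   = inj₂ (inj₂ (_ , refl))
  select⇒ □ stay₁   = inj₂ (inj₁ refl)

  controller : Player → Player → Contestant
  controller i j = if does (j ≟P i) then Spoiler else Duplicator

  -- The owner of the other vertex affects only the order of the moves, not who makes them.
  chooser-pair : ∀ i x y → chooser (pair i x y) (side i) ≡ controller i (𝒫 x)
  chooser-pair ◇ x y with 𝒫 x | 𝒫 y
  ... | ◇ | ◇ = refl
  ... | ◇ | □ = refl
  ... | □ | ◇ = refl
  ... | □ | □ = refl
  chooser-pair □ x y with 𝒫 x | 𝒫 y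
  ... | ◇ | ◇ = refl
  ... | ◇ | □ = refl
  ... | □ | ◇ = refl
  ... | □ | □ = refl

  γ-moved : ∀ m c c′ {u t} → u ≢ t → γ m c c′ u t ≡ ✓
  γ-moved Spoiler    c c′ {u} {t} ne rewrite dec-false (u Fin.≟ t) ne = refl
  γ-moved Duplicator c c′ {u} {t} ne rewrite dec-false (u Fin.≟ t) ne = refl

  γ-Duplicator : ∀ c c′ u → γ Duplicator c c′ u u ≡ †
  γ-Duplicator c c′ u rewrite dec-true (u Fin.≟ u) refl = refl

  γ-compatible : ∀ c c′ u → c ∈ₗ († ∷ ✓ ∷ c′ ∷ []) → γ Spoiler c c′ u u ≡ c′
  γ-compatible c c′ u c∈ rewrite dec-true (u Fin.≟ u) refl
    | dec-true (c ∈? († ∷ ✓ ∷ c′ ∷ [])) c∈ = refl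

  γ-incompatible : ∀ c c′ u → ¬ c ∈ₗ († ∷ ✓ ∷ c′ ∷ []) → γ Spoiler c c′ u u ≡ ✓
  γ-incompatible c c′ u c∉ rewrite dec-true (u Fin.≟ u) refl
    | dec-false (c ∈? († ∷ ✓ ∷ c′ ∷ [])) c∉ = refl

  -- The only challenge other than `✓` that can result from staying on `x` when `t` was chosen.
  held : Player → Vertex → Vertex → Challenge
  held i x t = if does (𝒫 x ≟P i) then ⟪ side i , t ⟫ else †

  γ-✓⊎held : ∀ b c c′ u t → let r = γ (if b then Spoiler else Duplicator) c c′ u t in
             r ≡ ✓ ⊎ (r ≡ (if b then c′ else †) × (b ≡ true → c ∈ₗ († ∷ ✓ ∷ c′ ∷ [])))
  γ-✓⊎held b c c′ u t = case u Fin.≟ t of λ where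
      (no ne)    → inj₁ (γ-moved (if b then Spoiler else Duplicator) c c′ ne)
      (yes refl) → held-or-✓ b
    where
    held-or-✓ : ∀ b → let r = γ (if b then Spoiler else Duplicator) c c′ u u in
                r ≡ ✓ ⊎ (r ≡ (if b then c′ else †) × (b ≡ true → c ∈ₗ († ∷ ✓ ∷ c′ ∷ [])))
    held-or-✓ false = inj₂ (γ-Duplicator c c′ u , λ ())
    held-or-✓ true  = case c ∈? († ∷ ✓ ∷ c′ ∷ []) of λ where
      (yes c∈) → inj₂ (γ-compatible c c′ u c∈ , λ _ → c∈)
      (no c∉)  → inj₁ (γ-incompatible c c′ u c∉)

  γ-held : ∀ b {c c′} u → c ≡ ✓ ⊎ c ≡ (if b then c′ else †) →
           γ (if b then Spoiler else Duplicator) c c′ u u ≡ (if b then c′ else †)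
  γ-held false {c} {c′} u _  = γ-Duplicator c c′ u
  γ-held true  u (inj₁ refl) = γ-compatible _ _ u (there (here refl))
  γ-held true  u (inj₂ refl) = γ-compatible _ _ u (there (there (here refl)))

  afterStay-✓⊎held : ∀ i vw c x y t → let r = afterStay i vw c x y t in
    r ≡ ✓ ⊎ (r ≡ held i x t × (𝒫 x ≡ i → c ∈ₗ († ∷ ✓ ∷ ⟪ side i , t ⟫ ∷ [])))
  afterStay-✓⊎held i vw c x y t rewrite chooser-pair i x y =
    map₂ (λ (e , f) → e , λ e′ → f (dec-true (𝒫 x ≟P i) e′))
      (γ-✓⊎held (does (𝒫 x ≟P i)) c ⟪ side i , t ⟫ (component vw (side i)) x)

  afterStay-moved : ∀ i vw c x y t → component vw (side i) ≢ x → afterStay i vw c x y t ≡ ✓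
  afterStay-moved i vw c x y t ne = γ-moved (chooser (pair i x y) (side i)) c ⟪ side i , t ⟫ ne

  afterStay-held : ∀ i {vw c x y t} → component vw (side i) ≡ x → c ≡ ✓ ⊎ c ≡ held i x t →
                   afterStay i vw c x y t ≡ held i x t
  afterStay-held i {x = x} {y} refl c≡ rewrite chooser-pair i x y =
    γ-held (does (𝒫 x ≟P i)) x c≡

  -- Unlike a play, a run may begin in the middle of a round, so that winning can be passed on move
  -- by move.
  record Run (s : DuplicatorStrategy) (p : Position) : Set where
    field
      at      : ℕ → Position
      first   : at 0 ≡ p
      step    : ∀ j → at j ⇒ at (suc j)
      follows : ∀ j (d : toMove (at j) ≡ Duplicator) →
                at (suc j) ≡ proj₁ (s (applyUpTo at j) (at j) d)

  Won : (ℕ → Position) → Set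
  Won at = (∀ j {v w c} → at j ≡ start ((v , w) , c) → Ω v ≡ Ω w)
         × (∀ m → ∃[ k ] (m ≤ k × (∃[ vw ] at k ≡ start (vw , ✓))))

  Winning : Pred Position 0ℓ
  Winning p = Σ[ s ∈ DuplicatorStrategy ] ((r : Run s p) → Won (Run.at r))

  Prescribed : ∀ {p} → Winning p → Pred Position 0ℓ
  Prescribed {p} (s , _) q = ∀ d → q ≡ proj₁ (s [] p d)

  -- The strategy from `q` prefixes `p` to each history; the winning condition survives the removal
  -- of the first position.
  Winning-tail : ∀ {p q} (w : Winning p) → p ⇒ q → Prescribed w q → Winning q
  Winning-tail {p} {q} (s , won) e pre = (λ h → s (p ∷ h)) , λ r →
    let priorities , rewarded = won (extend r) in
    (λ j → priorities (suc j)) ,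
    λ m → case rewarded (suc m) of λ { (suc k , s≤s m≤k , r) → k , m≤k , r }
    where
    extend : Run (λ h → s (p ∷ h)) q → Run s p
    extend r = record
      { at      = λ { zero → p ; (suc j) → Run.at r j }
      ; first   = refl
      ; step    = λ { zero    → subst (p ⇒_) (sym (Run.first r)) e
                    ; (suc j) → Run.step r j }
      ; follows = λ { zero    d → trans (Run.first r) (pre d)
                    ; (suc j) d → Run.follows r j d }
      }

  respond : ∀ {X p} → Ctrl Spoiler X p → (w : Winning p) →
            ∃[ q ] (p ⇒ q × Prescribed w q × X q)
  respond {p = p} (own , other) (s , _) with toMove p ≟Con Spoiler
  ... | yes e = let q , st , x = own e in
                q , st , (λ d → case trans (sym e) d of λ ()) , x
  ... | no ne = let q , st = s [] p (≢Spoiler ne) in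
                -- A strategy also receives the proof that Duplicator is to move; uniqueness of
                -- identity proofs makes its answer independent of that proof.
                q , st , (λ d → cong (proj₁ ∘ s [] p) (uip (≢Spoiler ne) d)) , other ne q st

  Ctrl-refutes : ∀ {p} → Ctrl Spoiler (∁ Winning) p → ¬ Winning p
  Ctrl-refutes c w = let _ , e , pre , ¬w = respond c w in ¬w (Winning-tail w e pre)

  module _ (Q : Pred Position 0ℓ)
           (force : ∀ p → Q p → Ctrl Spoiler (λ q → Winning q → Q q) p) where
    private
      next : ∀ {p} → Q p → (w : Winning p) →
             ∃[ q ] (p ⇒ q × Prescribed w q × (Winning q → Q q))
      next {p} = respond ∘ force p

      at : ∀ {p} → Q p → Winning p → ℕ → Position
      at {p} x w zero    = p
      at     x w (suc j) = let _ , e , pre , f = next x w ; w′ = Winning-tail w e pre in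
                           at (f w′) w′ j

      step : ∀ {p} (x : Q p) (w : Winning p) j → at x w j ⇒ at x w (suc j)
      step x w zero    = proj₁ (proj₂ (next x w))
      step x w (suc j) = step _ _ j

      follows : ∀ {p} (x : Q p) (w : Winning p) j (d : toMove (at x w j) ≡ Duplicator) →
                at x w (suc j) ≡ proj₁ (proj₁ w (applyUpTo (at x w) j) (at x w j) d)
      follows x w zero    = proj₁ (proj₂ (proj₂ (next x w)))
      follows x w (suc j) = follows _ _ j

      along : ∀ {p} (x : Q p) (w : Winning p) j → Q (at x w j)
      along x w zero    = x
      along x w (suc j) = along _ _ j

    -- Spoiler maintains `Q` while Duplicator follows her strategy, passed on to the tail after each
    -- move. Spoiler may rely on the new position being winning.
    play : ∀ {p} → Q p → Winning p → Σ[ f ∈ (ℕ → Position) ] (f 0 ≡ p × Won f × (∀ j → Q (f j)))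
    play x w = at x w , refl ,
      proj₂ w (record { at = at x w ; first = refl ; step = step x w ; follows = follows x w }) ,
      along x w

  -- Winning constrains runs only, so some run is needed; the trivial invariant supplies one.
  Winning⇒Ω : ∀ {v w c} → Winning (start ((v , w) , c)) → Ω v ≡ Ω w
  Winning⇒Ω win =
    let _ , first , (priorities , _) , _ =
          play (λ _ → ⊤) (λ p _ → (λ _ → let q , e = ⇒-total p in q , e , _) , _) _ win
    in priorities 0 first

  -- A play that never leaves `K` earns no reward. The four nested `Ctrl` are the four moves of a
  -- round.
  trap : (K : Pred Configuration 0ℓ) → (∀ {vw c} → K (vw , c) → c ≢ ✓) →
         (∀ κ → K κ → Ctrl Spoiler (Ctrl Spoiler (Ctrl Spoiler (Ctrl Spoiler
                        (AtStart λ κ′ → Winning (start κ′) → K κ′)))) (start κ)) →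
         ∀ {κ} → K κ → ¬ Winning (start κ)
  trap K unrewarded force {κ} k w =
    let _ , _ , (_ , rewarded) , along = play Q forceQ k w
        j , _ , _ , e = rewarded 0
    in unrewarded (subst Q e (along j)) refl
    where
    Goal : Pred Position 0ℓ
    Goal = AtStart λ κ′ → Winning (start κ′) → K κ′
    Q : Pred Position 0ℓ
    Q (start κ)        = K κ
    Q p@(move₁ _ _)    = Ctrl Spoiler (Ctrl Spoiler (Ctrl Spoiler Goal)) p
    Q p@(move₂ _ _ _)  = Ctrl Spoiler (Ctrl Spoiler Goal) p
    Q p@(select _ _ _) = Ctrl Spoiler Goal p
    forceQ : ∀ p → Q p → Ctrl Spoiler (λ q → Winning q → Q q) p
    forceQ (start κ)      k = Ctrl-map (λ { keep c _ → c ; swap c _ → c }) (force κ k)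
    forceQ (move₁ _ _)    = Ctrl-map λ { (choose₁ _) c _ → c }
    forceQ (move₂ _ _ _)  = Ctrl-map λ { (choose₂ _) c _ → c }
    forceQ (select _ _ _) = Ctrl-map λ { advance f → f ; stay₀ f → f ; stay₁ f → f }

  round-refutes : ∀ {κ} → Ctrl Spoiler (Ctrl Spoiler (Ctrl Spoiler (Ctrl Spoiler
                            (AtStart λ κ′ → ¬ Winning (start κ′))))) (start κ) → ¬ Winning (start κ)
  round-refutes = Ctrl-refutes ∘ Ctrl-map λ _ → Ctrl-refutes ∘ Ctrl-map λ _ → Ctrl-refutes ∘
    Ctrl-map λ _ → Ctrl-refutes ∘ Ctrl-map λ {q} _ → atStart q
    where
    atStart : ∀ q → AtStart (λ κ′ → ¬ Winning (start κ′)) q → ¬ Winning q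
    atStart (start _) f = f

  -- Spoiler makes exactly the choices of ◇ at `u₀` and of □ at `u₁`, so independent one-step
  -- strategies at the two vertices combine under every schedule.
  moves-Spoiler : ∀ {κ u₀ u₁ Z₀ Z₁ X} → Cpre ◇ Z₀ u₀ → Cpre □ Z₁ u₁ →
                  (∀ {t₀ t₁} → Z₀ t₀ → Z₁ t₁ → X (select κ (u₀ , u₁) (t₀ , t₁))) →
                  Ctrl Spoiler (Ctrl Spoiler X) (move₁ κ (u₀ , u₁))
  moves-Spoiler {κ} {u₀} {u₁} {X = X} c₀ c₁ f = byOwners _ _ refl refl
    where
    not : ∀ {j i v} → 𝒫 v ≡ j → j ≢ i → 𝒫 v ≢ i
    not e ne e′ = ne (trans (sym e) e′)
    byOwners : ∀ a b → 𝒫 u₀ ≡ a → 𝒫 u₁ ≡ b → Ctrl Spoiler (Ctrl Spoiler X) (move₁ κ (u₀ , u₁))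
    byOwners ◇ ◇ e₀ e₁ = moves {X = X} e₀ e₁
      ((λ _ → let t₀ , s₀ , z₀ = proj₁ c₀ e₀ in t₀ , s₀ ,
         (λ ()) , λ _ t₁ s₁ → f z₀ (proj₂ c₁ (not e₁ λ ()) t₁ s₁)) ,
       contradiction refl)
    byOwners ◇ □ e₀ e₁ = moves {X = X} e₀ e₁
      ((λ _ → let t₀ , s₀ , z₀ = proj₁ c₀ e₀ in t₀ , s₀ ,
         (λ _ → let t₁ , s₁ , z₁ = proj₁ c₁ e₁ in t₁ , s₁ , f z₀ z₁) , contradiction refl) ,
       contradiction refl)
    byOwners □ ◇ e₀ e₁ = moves {X = X} e₀ e₁
      ((λ ()) , λ _ t₁ s₁ → (λ ()) , λ _ t₀ s₀ →
         f (proj₂ c₀ (not e₀ λ ()) t₀ s₀) (proj₂ c₁ (not e₁ λ ()) t₁ s₁))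
    byOwners □ □ e₀ e₁ = moves {X = X} e₀ e₁
      ((λ _ → let t₁ , s₁ , z₁ = proj₁ c₁ e₁ in t₁ , s₁ ,
         (λ ()) , λ _ t₀ s₀ → f (proj₂ c₀ (not e₀ λ ()) t₀ s₀) z₁) ,
       contradiction refl)

  moves-pair : ∀ i {κ x y Zx Zy X} → Cpre i Zx x → Cpre (opp i) Zy y →
               (∀ {tx ty} → Zx tx → Zy ty → X (select κ (pair i x y) (pair i tx ty))) →
               Ctrl Spoiler (Ctrl Spoiler X) (move₁ κ (pair i x y))
  moves-pair ◇ cx cy f = moves-Spoiler cx cy f
  moves-pair □ cx cy f = moves-Spoiler cy cx λ zy zx → f zx zy

  Joins : Vertex × Vertex → Rel Vertex 0ℓ
  Joins vw x y = vw ≡ (x , y) ⊎ vw ≡ (y , x)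

  Joins-sym : ∀ {vw x y} → Joins vw x y → Joins vw y x
  Joins-sym = [ inj₂ , inj₁ ]′

  pair-Joins : ∀ i {x y} → Joins (pair i x y) x y
  pair-Joins ◇ = inj₁ refl
  pair-Joins □ = inj₂ refl

  component-pair : ∀ i {x y} → component (pair i x y) (side i) ≡ x
  component-pair ◇ = refl
  component-pair □ = refl

  enter : ∀ i {vw c x y} → Joins vw x y → start (vw , c) ⇒ move₁ (vw , c) (pair i x y)
  enter ◇ (inj₁ refl) = keep
  enter ◇ (inj₂ refl) = swap
  enter □ (inj₁ refl) = swap
  enter □ (inj₂ refl) = keep

  round-Spoiler : ∀ i {vw c x y Zx Zy} (P : Pred Configuration 0ℓ) → Joins vw x y →
                  Cpre i Zx x → Cpre (opp i) Zy y →
                  (∀ {tx ty} → Zx tx → Zy ty → P (pair i tx ty , ✓)) →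
                  (∀ {tx ty} → Zx tx → Zy ty → P (pair i x ty , afterStay i vw c x y tx)) →
                  (∀ {tx c′} → Zx tx → P (pair i tx y , c′)) →
                  Ctrl Spoiler (Ctrl Spoiler (Ctrl Spoiler (Ctrl Spoiler (AtStart P)))) (start (vw , c))
  round-Spoiler i {vw} {c} {x} {y} {Zx} {Zy} P joins cx cy adv stx sty =
    (λ _ → _ , enter i joins , moves-pair i {X = Ctrl Spoiler (AtStart P)} cx cy selected) ,
    contradiction refl
    where
    selected : ∀ {tx ty} → Zx tx → Zy ty →
               Ctrl Spoiler (AtStart P) (select (vw , c) (pair i x y) (pair i tx ty))
    selected zx zy = (λ ()) , λ _ q e → case select⇒ i e of λ where
      (inj₁ refl)              → adv zx zy
      (inj₂ (inj₁ refl))       → stx zx zy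
      (inj₂ (inj₂ (_ , refl))) → sty zx

  -- From x Spoiler plays the attractor strategy of player i, and from y a strategy of the
  -- opponent that avoids the attractor. Duplicator can postpone the descent of x forever only
  -- by staying on x, which leaves the challenge of Spoiler unanswered.
  module Forcing (i : Player) {U T : Pred Vertex 0ℓ} (U? : Decidable U) (T? : Decidable T)
    (U-closed : ∀ {vw c x y} → Joins vw x y → Winning (start (vw , c)) → U x → U y)
    (T-closed : ∀ {vw c x y} → Joins vw x y → Winning (start (vw , c)) → T x → T y) where

    private module A = Attractor i U? T?

    module _ {x : Vertex} (ux : U x) (h : Challenge) (h≢✓ : h ≢ ✓)
      (cx : Cpre i (λ t → A.Descends x t × held i x t ≡ h) x)
      (moved : ∀ {vw c x′ y} → A.Descends x x′ → ¬ A.Attr y → Joins vw x′ y →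
               ¬ Winning (start (vw , c))) where

      -- Advancing, or letting `y` stay, makes `x` descend and is refuted by `moved`. Only staying
      -- on `x` is left to `stx`.
      round : ∀ {vw c y} (P : Pred Configuration 0ℓ) → (∀ {κ} → ¬ Winning (start κ) → P κ) →
              Joins vw x y → ¬ A.Attr y → U y →
              (∀ {tx ty} → held i x tx ≡ h → ¬ A.Attr ty → P (pair i x ty , afterStay i vw c x y tx)) →
              Ctrl Spoiler (Ctrl Spoiler (Ctrl Spoiler (Ctrl Spoiler (AtStart P)))) (start (vw , c))
      round P refuted joins ¬ay uy stx = round-Spoiler i P joins cx (A.∉Attr-step ¬ay uy)
        (λ (d , _) ¬aty → refuted (moved d ¬aty (pair-Joins i)))
        (λ (_ , e) ¬aty → stx e ¬aty)
        (λ (d , _) → refuted (moved d ¬ay (pair-Joins i)))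

      -- Spoiler repeats his descent from `x`, so each further stay on `x` reproduces `h` without a
      -- reward.
      loses-held : ∀ {y} → ¬ A.Attr y → ¬ Winning (start (pair i x y , h))
      loses-held ¬ay w =
        trap K (λ (e , _) e′ → h≢✓ (trans (sym e) e′))
          (λ { (vw , c) (refl , y , refl , ¬ay , uy) →
               round _ (λ ¬w w → contradiction w ¬w) (pair-Joins i) ¬ay uy λ {tx} e ¬aty w →
                 trans (afterStay-held i (component-pair i) (inj₂ (sym e))) e ,
                 _ , refl , ¬aty , U-closed (pair-Joins i) w ux })
          (refl , _ , refl , ¬ay , U-closed (pair-Joins i) w ux) w
        where
        K : Pred Configuration 0ℓ
        K (vw , c) = c ≡ h × ∃[ y ] (vw ≡ pair i x y × ¬ A.Attr y × U y)

      loses-✓ : ∀ {y} → ¬ A.Attr y → ¬ Winning (start (pair i x y , ✓))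
      loses-✓ ¬ay w = round-refutes
        (round _ id (pair-Joins i) ¬ay (U-closed (pair-Joins i) w ux) λ e ¬aty →
          subst (λ c → ¬ Winning (start (_ , c)))
            (sym (trans (afterStay-held i (component-pair i) (inj₁ refl)) e)) (loses-held ¬aty)) w

      -- From an arbitrary challenge the first stay may earn a reward, but the next one turns `✓`
      -- into `h`.
      loses : ∀ {vw c y} → Joins vw x y → ¬ A.Attr y → ¬ Winning (start (vw , c))
      loses {c = c} joins ¬ay w = round-refutes
        (round _ id joins ¬ay (U-closed joins w ux) λ {tx} e ¬aty →
          [ (λ e′ → subst (λ c → ¬ Winning (start (_ , c))) (sym e′) (loses-✓ ¬aty))
          , (λ (e′ , _) → subst (λ c → ¬ Winning (start (_ , c))) (sym (trans e′ e)) (loses-held ¬aty))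
          ]′ (afterStay-✓⊎held i _ c _ _ tx)) w

    -- At a vertex of `i` Spoiler commits to a single successor; at other vertices staying gives `†`
    -- whatever the move. Either way the held challenge is constant.
    hold : ∀ {x Z} → Cpre i Z x → ∃[ h ] (h ≢ ✓ × Cpre i (λ t → Z t × held i x t ≡ h) x)
    hold {x} (own , other) with 𝒫 x ≟P i
    ... | no ne = † , (λ ()) , (λ e → contradiction e ne) , λ _ t s → other ne t s , refl
    ... | yes e = let t , s , z = own e in
                  ⟪ side i , t ⟫ , (λ ()) , (λ _ → t , s , z , refl) , contradiction e

    refuted : ∀ r {vw c x y} → A.rank x < r → A.Attr x → ¬ A.Attr y → Joins vw x y →
              ¬ Winning (start (vw , c))
    refuted (suc r) (s≤s le) ax ¬ay joins w =
      -- If `x` were in `T`, then so would be `y`, which is outside the attractor.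
      let ux , cx = A.descend ax (A.∉Attr⇒∉T ¬ay ∘ T-closed joins w)
          h , h≢✓ , cx′ = hold cx
      in loses ux h h≢✓ cx′
           (λ (ax′ , lt) → refuted r (ℕ.<-≤-trans lt le) ax′) joins ¬ay w

    Attr-transfer : ∀ {vw c x y} → Joins vw x y → Winning (start (vw , c)) → A.Attr x → A.Attr y
    Attr-transfer {y = y} joins w ax = decidable-stable (A.Attr? y) λ ¬ay →
      refuted _ ℕ.≤-refl ax ¬ay joins w

-- From winning strategies to a bisimulation.

module FromGame (G : ParityGame) where
  open ParityGame G
  open Bisimulation G
  open BisimulationGame G
  open Attraction G
  open Rounds G

  Linked : Rel Vertex 0ℓ
  Linked x y = ∃[ vw ] ∃[ c ] (Joins vw x y × Winning (start (vw , c)))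

  -- The equivalence closure of Linked.
  _~_ : Rel Vertex 0ℓ
  v ~ w = (f : Vertex → Bool) → (∀ {x y} → Linked x y → f x ≡ f y) → f v ≡ f w

  ~-isEquivalence : IsEquivalence _~_
  ~-isEquivalence = record
    { refl  = λ _ _ → refl
    ; sym   = λ v~w f inv → sym (v~w f inv)
    ; trans = λ u~v v~w f inv → trans (u~v f inv) (v~w f inv)
    }

  open IsEquivalence ~-isEquivalence using () renaming (refl to ~-refl; sym to ~-sym; trans to ~-trans)

  Winning⇒~ : ∀ {vw c x y} → Joins vw x y → Winning (start (vw , c)) → x ~ y
  Winning⇒~ joins w f inv = inv (_ , _ , joins , w)

  -- The characteristic function of `X` is among the Boolean functions that `_~_` quantifies over;
  -- symmetry of `Joins` gives its invariance in both directions.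
  ~-preserves : ∀ {X : Pred Vertex 0ℓ} → Decidable X → (∀ {x y} → Linked x y → X x → X y) →
                ∀ {v w} → v ~ w → X v → X w
  ~-preserves X? closed {w = w} v~w x = decidable-stable (X? w) λ ¬x →
    case trans (sym (dec-true (X? _) x)) (trans (v~w (does ∘ X?) invariant) (dec-false (X? w) ¬x))
    of λ ()
    where
    invariant : ∀ {x y} → Linked x y → does (X? x) ≡ does (X? y)
    invariant (vw , c , joins , w) =
      does-⇔ (mk⇔ (closed (vw , c , joins , w)) (closed (vw , c , Joins-sym joins , w))) (X? _) (X? _)

  module _ (_~?_ : Binary.Decidable _~_) where

    forcing : ∀ i {U T : Pred Vertex 0ℓ} (U? : Decidable U) (T? : Decidable T) →
              (∀ {x y} → x ~ y → U x → U y) → (∀ {x y} → x ~ y → T x → T y) →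
              ∀ {v w} → v ~ w → Attr i U? T? v → Attr i U? T? w
    forcing i U? T? U-closed T-closed =
      ~-preserves (Attr? i U? T?) λ (_ , _ , joins , w) →
        Forcing.Attr-transfer i U? T?
          (λ joins w → U-closed (Winning⇒~ joins w))
          (λ joins w → T-closed (Winning⇒~ joins w)) joins w

    ~-isGovernedStutteringBisimulation : IsGovernedStutteringBisimulation _~_
    ~-isGovernedStutteringBisimulation = record
      { isEquivalence = ~-isEquivalence
      ; priority      = λ {v} v~w → ~-preserves (λ w → Ω v ℕ.≟ Ω w) priority v~w refl
      ; transfer      = λ {v} {w} v~w u _ (t , s , u~t) →
          let module A = Attractor (𝒫 v) (w ~?_) (u ~?_) in
          Attr⇒↦ (w ~?_) (u ~?_)
            (forcing (𝒫 v) (w ~?_) (u ~?_) (λ e e′ → ~-trans e′ e) (λ e e′ → ~-trans e′ e) v~w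
              -- `v` lies in the class of `w`, and its owner can move to the class of `u` at once.
              (A.Attr-closed (~-sym v~w) ((λ _ → t , s , A.T⊆Attr u~t) , contradiction refl)))
      ; divergence    = λ {v} {w} v~w i d →
          -- By determinacy, failure at `w` would be an escape for the opponent, and `forcing` would
          -- carry it back to `v`.
          ↦∞-mono {U = v ~_} {w ~_} (λ {x} → ~-trans {w} {v} {x} (~-sym v~w))
            (∉Escape⇒↦∞ (v ~?_) λ a → ↦∞⇒∉Escape (v ~?_) d
              (forcing (opp i) U? (∁? (v ~?_)) _ (λ e ¬e e′ → ¬e (~-trans e′ (~-sym e)))
                (~-sym v~w) a))
      }
      where
      priority : ∀ {v x y} → Linked x y → Ω v ≡ Ω x → Ω v ≡ Ω y
      priority (_ , _ , inj₁ refl , w) e = trans e (Winning⇒Ω w)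
      priority (_ , _ , inj₂ refl , w) e = trans e (sym (Winning⇒Ω w))

  DuplicatorWins⇒~ : ∀ {v w} → DuplicatorWins v w → v ~ w
  DuplicatorWins⇒~ (s , won) = Winning⇒~ (inj₁ refl) (s , λ r →
    let p = record { at = Run.at r ; first = Run.first r ; step = Run.step r }
        open WonByDuplicator (won p (Run.follows r))
    in priorities , rewarded)

-- Decidability of bisimilarity.

module Bisimilarity (G : ParityGame) where
  open ParityGame G
  open Bisimulation G
  open Attraction G

  IsGSB-resp : ∀ {R S : Rel Vertex 0ℓ} → (∀ {v w} → R v w → S v w) → (∀ {v w} → S v w → R v w) →
               IsGovernedStutteringBisimulation R → IsGovernedStutteringBisimulation S
  IsGSB-resp {R} {S} to from gsb = record
    { isEquivalence = record { refl = to E.refl ; sym = to ∘ E.sym ∘ from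
                             ; trans = λ e f → to (E.trans (from e) (from f)) }
    ; priority   = priority ∘ from
    ; transfer   = λ e u ne (t , s , f) →
        let st , wins = transfer (from e) u
              (λ (sub , sup) → ne (to ∘ sub ∘ from , to ∘ sup ∘ from)) (t , s , from f)
        in st , λ p a → let n , t , us = wins p a in n , to t , λ j j<n → to (us j j<n)
    ; divergence = λ {v} {w} e i d → ↦∞-mono {U = R w} {S w} to (divergence (from e) i (↦∞-mono {U = S v} {R v} from d))
    }
    where
    open IsGovernedStutteringBisimulation gsb
    module E = IsEquivalence isEquivalence

  -- All quantifiers range over vertices or players, and both forcing relations are decided by
  -- attractors.
  IsGSB? : ∀ {R : Rel Vertex 0ℓ} → Binary.Decidable R → Dec (IsGovernedStutteringBisimulation R)
  IsGSB? {R} R? = map′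
    (λ (r , s , t , p , tr , d) → record
      { isEquivalence = record { refl = r _ ; sym = s _ _ ; trans = t _ _ _ }
      ; priority = p _ _ ; transfer = tr _ _ ; divergence = d _ _ })
    (λ gsb → let open IsGovernedStutteringBisimulation gsb
                 module E = IsEquivalence isEquivalence in
      (λ _ → E.refl) , (λ _ _ → E.sym) , (λ _ _ _ → E.trans) ,
      (λ _ _ → priority) , (λ _ _ → transfer) , λ _ _ → divergence)
    ((all λ v → R? v v) ×-dec
     (all λ v → all λ w → R? v w →-dec R? w v) ×-dec
     (all λ u → all λ v → all λ w → R? u v →-dec (R? v w →-dec R? u w)) ×-dec
     (all λ v → all λ w → R? v w →-dec (Ω v ℕ.≟ Ω w)) ×-dec
     (all λ v → all λ w → R? v w →-dec
       all λ u → ¬? (sub? u v ×-dec sub? v u) →-dec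
         (∃⟶? (R? u) v →-dec ↦? {𝒫 v} (R? w) (R? u) w)) ×-dec
     (all λ v → all λ w → R? v w →-dec
       players λ i → ↦∞? {i} (R? v) v →-dec ↦∞? {i} (R? w) w))
    where
    all : ∀ {X : Pred Vertex 0ℓ} → Decidable X → Dec (∀ v → X v)
    all = Fin.all?
    sub? : ∀ u v → Dec (∀ {x} → R u x → R v x)
    sub? u v = map′ (λ f {x} → f x) (λ f x → f {x}) (all λ x → R? u x →-dec R? v x)
    players : ∀ {X : Pred Player 0ℓ} → Decidable X → Dec (∀ i → X i)
    players X? = map′ (λ { (x , y) ◇ → x ; (x , y) □ → y }) (λ f → f ◇ , f □) (X? ◇ ×-dec X? □)

  -- Relations coded as subsets of a finite set, over which existence is decidable.
  ⟦_⟧ : Subset (size * size) → Rel Vertex 0ℓ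
  ⟦ p ⟧ v w = combine v w Subset.∈ p

  ⟦_⟧? : ∀ p → Binary.Decidable ⟦ p ⟧
  ⟦ p ⟧? v w = combine v w Subset.∈? p

  -- Double negation commutes with quantification over a finite set.
  ¬¬-decide : ∀ (R : Rel Vertex 0ℓ) → ¬ ¬ Binary.Decidable R
  ¬¬-decide R = sequence λ v → sequence λ w → ¬¬-excluded-middle
    where
    sequence : ∀ {P : Pred Vertex 0ℓ} → (∀ v → ¬ ¬ P v) → ¬ ¬ (∀ v → P v)
    sequence = Fin.sequence (RawMonad.rawApplicative ¬¬-Monad)

  graph : ∀ {R : Rel Vertex 0ℓ} → Binary.Decidable R → Subset (size * size)
  graph R? = tabulate (λ k → does (uncurry R? (remQuot size k)))

  graph-does : ∀ {R} (R? : Binary.Decidable R) v w → lookup (graph R?) (combine v w) ≡ does (R? v w)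
  graph-does R? v w = trans (lookup∘tabulate _ (combine v w))
    (cong (does ∘ uncurry R?) (Fin.remQuot-combine v w))

  to-graph : ∀ {R} (R? : Binary.Decidable R) {v w} → R v w → ⟦ graph R? ⟧ v w
  to-graph R? {v} {w} r = lookup⇒[]= _ _ (trans (graph-does R? v w) (dec-true (R? v w) r))

  from-graph : ∀ {R} (R? : Binary.Decidable R) {v w} → ⟦ graph R? ⟧ v w → R v w
  from-graph R? {v} {w} m = decidable-stable (R? v w) λ ¬r →
    case trans (sym ([]=⇒lookup m)) (trans (graph-does R? v w) (dec-false (R? v w) ¬r)) of λ ()

  -- There are finitely many relations on the vertices, so that bisimilarity is decidable and a
  -- bisimulation may be assumed to be so.
  decidableGSB : ∀ (R : Rel Vertex 0ℓ) → (Binary.Decidable R → IsGovernedStutteringBisimulation R) →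
                 ∀ {v w} → R v w →
                 Σ[ S ∈ Rel Vertex 0ℓ ] (Binary.Decidable S × IsGovernedStutteringBisimulation S × S v w)
  decidableGSB R gsb {v} {w} r =
    -- The existence of a suitable `p` is decidable, hence stable, so `R` may be assumed decidable
    -- in proving it.
    let p , g , s = decidable-stable (anySubset? λ p → IsGSB? ⟦ p ⟧? ×-dec ⟦ p ⟧? v w)
          λ none → ¬¬-decide R λ R? →
            none (graph R? , IsGSB-resp (to-graph R?) (from-graph R?) (gsb R?) , to-graph R? r)
    in ⟦ p ⟧ , ⟦ p ⟧? , g , s

-- From a bisimulation to a winning strategy.

module ToGame (G : ParityGame) where
  open ParityGame G
  open Bisimulation G
  open BisimulationGame G
  open Attraction G
  open Rounds G

  module _ {R : Rel Vertex 0ℓ} (R? : Binary.Decidable R)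
           (gsb : IsGovernedStutteringBisimulation R) where
    open IsGovernedStutteringBisimulation gsb
    open IsEquivalence isEquivalence using () renaming (refl to R-refl; sym to R-sym; trans to R-trans)

    rank-challenge : Player → Vertex → Vertex → Vertex → ℕ
    rank-challenge i x t = Attractor.rank i (R? x) (R? t)

    rank-escape : Player → Vertex → Vertex → ℕ
    rank-escape i x = Attractor.rank i U? (∁? (R? x))

    -- On side `i` Duplicator moves at `x`, but cannot keep it in its class.
    Stuck : Player → Vertex → Set
    Stuck i x = 𝒫 x ≢ i × (∀ t → x ⟶ t → ¬ R x t)

    Stuck? : ∀ i → Decidable (Stuck i)
    Stuck? i x = ¬? (𝒫 x ≟P i) ×-dec ∀↝? ∃⟶? (λ t → ¬? (R? x t)) x

    -- The two reasons for Duplicator to wait at `x`, each with the attractor rank that the move of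
    -- `y` decreases.
    data Stays (i : Player) (x y tx ty : Vertex) : Set where
      challenged : 𝒫 x ≡ i → ¬ R x tx → R x ty →
                   rank-challenge i x tx ty < rank-challenge i x tx y → Stays i x y tx ty
      stuck      : Stuck i x → R x ty → rank-escape i x ty < rank-escape i x y → Stays i x y tx ty

    Stays⇒R : ∀ {i x y tx ty} → Stays i x y tx ty → R x ty
    Stays⇒R (challenged _ _ r _) = r
    Stays⇒R (stuck _ r _)        = r

    Attr-challenge : ∀ {i x y t} → R x y → 𝒫 x ≡ i → x ⟶ t → ¬ R x t → Attr i (R? x) (R? t) y
    Attr-challenge {x = x} {y} {t} r refl s ¬r = ↦⇒Attr (R? x) (R? t)
      (↦-mono {U = R y} {R x} {R t} (R-trans r) (transfer r t (λ (sub , _) → ¬r (sub R-refl)) (t , s , R-refl)))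

    -- Otherwise the opponent of `i` could keep `y` in the class forever and, by divergence, `x` as
    -- well; but every move from `x` leaves it.
    Attr-escape : ∀ i {x y} → R x y → Stuck i x → Attr i U? (∁? (R? x)) y
    Attr-escape i {x} {y} r (ne , out) =
      subst (λ k → Attr k U? (∁? (R? x)) y) (opp-involutive i)
        (decidable-stable (Attr? (opp (opp i)) U? (∁? (R? x)) y) λ ¬a →
          ↦∞⇒∉Escape (R? x)
            (divergence (R-sym r) (opp i) (↦∞-mono {U = R x} {R y} (R-trans (R-sym r)) (∉Escape⇒↦∞ (R? x) ¬a)))
            (A.Attr-closed _ ((λ e → contradiction (trans e (opp-involutive i)) ne) ,
                              λ _ t s → A.T⊆Attr (out t s))))
      where module A = Attractor (opp (opp i)) U? (∁? (R? x))

    answer : ∀ {i x y tx} → R x y → 𝒫 x ≡ i → x ⟶ tx → ¬ R x tx →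
             Cpre i (λ ty → R tx ty ⊎ Stays i x y tx ty) y
    answer {i} {x} {y} {tx} r e s ¬r = Cpre-map (λ _ → answered)
      (proj₂ (A.descend (Attr-challenge r e s ¬r) λ r′ → ¬r (R-trans r (R-sym r′))))
      where
      module A = Attractor i (R? x) (R? tx)
      answered : ∀ {ty} → A.Descends y ty → R tx ty ⊎ Stays i x y tx ty
      answered {ty} (a , lt) with R? tx ty
      ... | yes r′ = inj₁ r′
      ... | no ¬r′ = inj₂ (challenged e ¬r (proj₁ (A.descend a ¬r′)) lt)

    escape : ∀ {i x y} tx → R x y → Stuck i x → Cpre i (λ ty → ¬ R x ty ⊎ Stays i x y tx ty) y
    escape {i} {x} {y} tx r st = Cpre-map (λ _ → escaping)
      (proj₂ (A.descend (Attr-escape i r st) (contradiction r)))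
      where
      module A = Attractor i U? (∁? (R? x))
      escaping : ∀ {ty} → A.Descends y ty → ¬ R x ty ⊎ Stays i x y tx ty
      escaping {ty} (_ , lt) with R? x ty
      ... | yes r′ = inj₂ (stuck st r′ lt)
      ... | no ¬r′ = inj₁ ¬r′

    Outcome : Player → (x y tx ty : Vertex) → Set
    Outcome i x y tx ty = R tx ty ⊎ Stays i x y tx ty ⊎ Stays (opp i) y x ty tx

    left : ∀ {i x y tx ty} → R tx ty ⊎ Stays i x y tx ty → Outcome i x y tx ty
    left = map₂ inj₁

    right : ∀ {i x y tx ty} → R ty tx ⊎ Stays (opp i) y x ty tx → Outcome i x y tx ty
    right = [ inj₁ ∘ R-sym , inj₂ ∘ inj₂ ]′

    ≡opp⇒≢ : ∀ {i j} → j ≡ opp i → j ≢ i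
    ≡opp⇒≢ {i} e e′ = opp≢ i (trans (sym e) e′)

    ≡⇒≢opp : ∀ {i j} → j ≡ i → j ≢ opp i
    ≡⇒≢opp {i} e e′ = opp≢ i (trans (sym e′) e)

    -- The suffix tells who moves at `x` and at `y`. If `tx` leaves the class, every move of `y`
    -- descends towards `tx`, since `y` is not owned by `i`.
    outcome-SS : ∀ {i x y tx ty} → R x y → 𝒫 x ≡ i → 𝒫 y ≡ opp i → x ⟶ tx → y ⟶ ty →
                 Outcome i x y tx ty
    outcome-SS {x = x} {y} {tx} {ty} r ex ey sx sy with R? x tx | R? x ty
    ... | no ¬rx | _      = left (proj₂ (answer r ex sx ¬rx) (≡opp⇒≢ ey) ty sy)
    ... | yes rx | no ¬ry = right (proj₂ (answer (R-sym r) ey sy (¬ry ∘ R-trans r)) (≡⇒≢opp ex) tx sx)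
    ... | yes rx | yes ry = inj₁ (R-trans (R-sym rx) ry)

    outcome-SD : ∀ {i x y tx} → R x y → 𝒫 x ≡ i → 𝒫 y ≡ i → x ⟶ tx →
                 ∃[ ty ] (y ⟶ ty × Outcome i x y tx ty)
    outcome-SD {i} {x} {y} {tx} r ex ey sx with R? x tx
    ... | no ¬rx = let ty , sy , o = proj₁ (answer r ex sx ¬rx) ey in ty , sy , left o
    ... | yes rx with ∃⟶? (R? x) y
    ...   | yes (ty , sy , ry) = ty , sy , inj₁ (R-trans (R-sym rx) ry)
    -- Now `y` is stuck while `tx` stays in the class, so Duplicator waits at `y`, and every move of
    -- `x` descends in the escape rank.
    ...   | no ¬∃ = let ty , sy = total y in ty , sy ,
      [ contradiction (R-trans (R-sym r) rx) , inj₂ ∘ inj₂ ]′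
        (proj₂ (escape ty (R-sym r) (≡⇒≢opp ey , λ t s r′ → ¬∃ (t , s , R-trans r r′)))
           (≡⇒≢opp ex) tx sx)

    -- By transfer the owner of `x` can force `y` to the class of `tx`. Since `y` belongs to the
    -- other player, any move of `y` out of the class must enter that of `tx`.
    answer-stuck : ∀ {i x y tx} → R x y → 𝒫 x ≡ opp i → 𝒫 y ≡ i →
                   (∀ t → x ⟶ t → ¬ R x t) → x ⟶ tx →
                   ∃[ ty ] (y ⟶ ty × (R tx ty ⊎ Stays i x y tx ty))
    answer-stuck {tx = tx} r ex ey out sx =
      let ty , sy , o = proj₁ (escape tx r (≡opp⇒≢ ex , out)) ey in ty , sy ,
      [ (λ ¬r → inj₁ ([ id , (λ st → contradiction (Stays⇒R st) ¬r) ]′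
           (proj₂ (answer r ex sx (out tx sx)) (≡⇒≢opp ey) ty sy)))
      , inj₂ ]′ o

    outcome-DD : ∀ {i x y} → R x y → 𝒫 x ≡ opp i → 𝒫 y ≡ i →
                 ∃[ ty ] (y ⟶ ty × ∃[ tx ] (x ⟶ tx × Outcome i x y tx ty))
    outcome-DD {i} {x} {y} r ex ey with ∃⟶? (R? x) x | ∃⟶? (R? y) y
    ... | yes (tx , sx , rx) | yes (ty , sy , ry) =
      ty , sy , tx , sx , inj₁ (R-trans (R-sym rx) (R-trans r ry))
    ... | no ¬∃ | _ =
      let tx , sx = total x
          ty , sy , o = answer-stuck r ex ey (λ t s r′ → ¬∃ (t , s , r′)) sx
      in ty , sy , tx , sx , left o
    ... | yes _ | no ¬∃ =
      let ty , sy = total y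
          tx , sx , o = answer-stuck (R-sym r) (trans ey (sym (opp-involutive i))) ex
                          (λ t s r′ → ¬∃ (t , s , r′)) sy
      in ty , sy , tx , sx , right o

    -- The invariant on challenges and the decreasing measure.

    owner : Component → Player
    owner 0F = ◇
    owner 1F = □

    Justified : Vertex × Vertex → Pred Challenge 0ℓ
    Justified vw ⟪ k , t ⟫ = 𝒫 x ≡ owner k × x ⟶ t × ¬ R x t
      where x = component vw k
    Justified (v , w) † = Stuck ◇ v ⊎ Stuck □ w
    Justified vw ✓ = ⊤

    Justified? : ∀ vw → Decidable (Justified vw)
    Justified? vw ⟪ k , t ⟫ = (𝒫 x ≟P owner k) ×-dec ((x ⟶? t) ×-dec ¬? (R? x t))
      where x = component vw k
    Justified? (v , w) † = Stuck? ◇ v ⊎-dec Stuck? □ w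
    Justified? vw ✓ = yes _

    Good : Pred Configuration 0ℓ
    Good ((v , w) , c) = R v w × Justified (v , w) c

    -- If both vertices are stuck, then the next round can be answered by a match.
    rank-stuck : Vertex → Vertex → ℕ
    rank-stuck v w = if does (Stuck? ◇ v)
                     then (if does (Stuck? □ w) then 0 else rank-escape ◇ v w)
                     else rank-escape □ w v

    -- Without a reward, a challenge either stays or turns into †, and † stays: the first component
    -- never grows. The rank of the vertex that moves decreases as long as it is constant.
    μ : Configuration → ℕ × ℕ
    μ ((v , w) , ⟪ 0F , t ⟫) = 1 , rank-challenge ◇ v t w
    μ ((v , w) , ⟪ 1F , t ⟫) = 1 , rank-challenge □ w t v
    μ ((v , w) , †)          = 0 , rank-stuck v w
    μ (_       , ✓)          = 2 , 0

    _≺_ : Rel (ℕ × ℕ) 0ℓ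
    _≺_ = ×-Lex _≡_ _<_ _<_

    _≺?_ : Binary.Decidable _≺_
    _≺?_ = ×-decidable ℕ._≟_ ℕ._<?_ ℕ._<?_

    Next : Rel Configuration 0ℓ
    Next κ κ′ = Good κ′ × (proj₂ κ′ ≡ ✓ ⊎ μ κ′ ≺ μ κ)

    Next? : ∀ κ → Decidable (Next κ)
    Next? κ κ′@((v , w) , c) = (R? v w ×-dec Justified? (v , w) c) ×-dec ((c ≟C ✓) ⊎-dec (μ κ′ ≺? μ κ))

    Next-✓ : ∀ κ {v w c} → R v w → c ≡ ✓ → Next κ ((v , w) , c)
    Next-✓ _ r refl = (r , _) , inj₁ refl

    Next-pair-✓ : ∀ i κ {x y c} → R x y → c ≡ ✓ → Next κ (pair i x y , c)
    Next-pair-✓ ◇ κ r e = Next-✓ κ r e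
    Next-pair-✓ □ κ r e = Next-✓ κ (R-sym r) e

    rank-stuck-≤ : ∀ i {x y} → Stuck i x → uncurry rank-stuck (pair i x y) ≤ rank-escape i x y
    rank-stuck-≤ ◇ {x} {y} st rewrite dec-true (Stuck? ◇ x) st with does (Stuck? □ y)
    ... | true  = z≤n
    ... | false = ℕ.≤-refl
    rank-stuck-≤ □ {x} {y} st with does (Stuck? ◇ y)
    ... | true  rewrite dec-true (Stuck? □ x) st = z≤n
    ... | false = ℕ.≤-refl

    rank-stuck-≡ : ∀ i {x y} → Stuck i x → ¬ Stuck (opp i) y →
                   uncurry rank-stuck (pair i x y) ≡ rank-escape i x y
    rank-stuck-≡ ◇ {x} {y} st ¬st
      rewrite dec-true (Stuck? ◇ x) st | dec-false (Stuck? □ y) ¬st = refl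
    rank-stuck-≡ □ {x} {y} st ¬st rewrite dec-false (Stuck? ◇ y) ¬st = refl

    module _ {c : Challenge} {x y tx ty : Vertex} (r : R x y) (sy : y ⟶ ty) (r′ : R x ty) where

      not-stuck : ∀ {i} → ¬ Stuck i y
      not-stuck (_ , out) = out ty sy (R-trans (R-sym r) r′)

      Next-challenged : ∀ i → Justified (pair i x y) c → x ⟶ tx → 𝒫 x ≡ i → ¬ R x tx →
                        rank-challenge i x tx ty < rank-challenge i x tx y →
                        c ∈ₗ († ∷ ✓ ∷ ⟪ side i , tx ⟫ ∷ []) →
                        Next (pair i x y , c) (pair i x ty , ⟪ side i , tx ⟫)
      Next-challenged ◇ j sx e ¬r lt = λ where
        -- `†` would need a stuck vertex, but `x` is owned by `i` and `y` has a successor in the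
        -- class.
        (here refl) → ⊥-elim ([ (λ (ne , _) → ne e) , not-stuck ]′ j)
        (there (here refl)) → (r′ , e , sx , ¬r) , inj₂ (inj₁ ℕ.≤-refl)
        (there (there (here refl))) → (r′ , e , sx , ¬r) , inj₂ (inj₂ (refl , lt))
      Next-challenged □ j sx e ¬r lt = λ where
        (here refl) → ⊥-elim ([ not-stuck , (λ (ne , _) → ne e) ]′ j)
        (there (here refl)) → (R-sym r′ , e , sx , ¬r) , inj₂ (inj₁ ℕ.≤-refl)
        (there (there (here refl))) → (R-sym r′ , e , sx , ¬r) , inj₂ (inj₂ (refl , lt))

      Good-stuck : ∀ i → Stuck i x → Good (pair i x ty , †)
      Good-stuck ◇ st = r′ , inj₁ st
      Good-stuck □ st = R-sym r′ , inj₂ st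

      Next-stuck : ∀ i → Stuck i x → rank-escape i x ty < rank-escape i x y →
                   Next (pair i x y , c) (pair i x ty , †)
      Next-stuck i st lt = Good-stuck i st , inj₂ (descends c)
        where
        descends : ∀ c → μ (pair i x ty , †) ≺ μ (pair i x y , c)
        descends ⟪ 0F , _ ⟫ = inj₁ ℕ.≤-refl
        descends ⟪ 1F , _ ⟫ = inj₁ ℕ.≤-refl
        -- Before the move `y` is not stuck, so the old value is exactly its escape rank; for the
        -- new value an upper bound suffices.
        descends † = inj₂ (refl , ℕ.≤-<-trans (rank-stuck-≤ i st)
          (subst (rank-escape i x ty <_) (sym (rank-stuck-≡ i st not-stuck)) lt))
        descends ✓ = inj₁ (s≤s z≤n)

      Next-Stays : ∀ i → Justified (pair i x y) c → x ⟶ tx → Stays i x y tx ty →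
                   Next (pair i x y , c) (pair i x ty , afterStay i (pair i x y) c x y tx)
      Next-Stays i j sx st with afterStay-✓⊎held i (pair i x y) c x y tx
      ... | inj₁ e = Next-pair-✓ i (pair i x y , c) r′ e
      ... | inj₂ (e , c∈) = subst (λ c′ → Next (pair i x y , c) (pair i x ty , c′)) (sym e) (held-Next st)
        where
        held-Next : Stays i x y tx ty → Next (pair i x y , c) (pair i x ty , held i x tx)
        held-Next (challenged e ¬r _ lt) rewrite dec-true (𝒫 x ≟P i) e =
          Next-challenged i j sx e ¬r lt (c∈ e)
        held-Next (stuck st _ lt) rewrite dec-false (𝒫 x ≟P i) (proj₁ st) =
          Next-stuck i st lt

    Selectable : Configuration → Vertex × Vertex → Vertex × Vertex → Set
    Selectable κ u t = ∃[ q ] (select κ u t ⇒ q × AtStart (Next κ) q)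

    select-keep : ∀ {v w c t₀ t₁} → Good ((v , w) , c) → v ⟶ t₀ → w ⟶ t₁ →
                  Outcome ◇ v w t₀ t₁ → Selectable ((v , w) , c) (v , w) (t₀ , t₁)
    select-keep {v} {w} {c} (r , j) s₀ s₁ = λ where
      (inj₁ r′)        → _ , advance , Next-✓ ((v , w) , c) r′ refl
      (inj₂ (inj₁ st)) → _ , stay ◇ , Next-Stays r s₁ (Stays⇒R st) ◇ j s₀ st
      (inj₂ (inj₂ st)) → _ , stay □ , Next-Stays (R-sym r) s₀ (Stays⇒R st) □ j s₁ st

    -- After a swap of distinct vertices the vertex that stays differs from the previous one on its
    -- side, so every stay is rewarded.
    select-swap : ∀ {v w c t₀ t₁} → v ≢ w → Outcome ◇ w v t₀ t₁ →
                  Selectable ((v , w) , c) (w , v) (t₀ , t₁)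
    select-swap {v} {w} {c} {t₀} {t₁} ne = λ where
      (inj₁ r′)        → _ , advance , Next-✓ ((v , w) , c) r′ refl
      (inj₂ (inj₁ st)) → _ , stay ◇ ,
        Next-✓ ((v , w) , c) (Stays⇒R st) (afterStay-moved ◇ (v , w) c w v t₀ ne)
      (inj₂ (inj₂ st)) → _ , stay □ ,
        Next-✓ ((v , w) , c) (R-sym (Stays⇒R st)) (afterStay-moved □ (v , w) c v w t₁ (ne ∘ sym))

    moves-Duplicator : ∀ {κ u₀ u₁} → R u₀ u₁ →
      (∀ {t₀ t₁} → u₀ ⟶ t₀ → u₁ ⟶ t₁ → Outcome ◇ u₀ u₁ t₀ t₁ → Selectable κ (u₀ , u₁) (t₀ , t₁)) →
      Ctrl Duplicator (Ctrl Duplicator (Ctrl Duplicator (AtStart (Next κ)))) (move₁ κ (u₀ , u₁))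
    moves-Duplicator {κ} {u₀} {u₁} r f = byOwners _ _ refl refl
      where
      X : Pred Position 0ℓ
      X = Ctrl Duplicator (AtStart (Next κ))
      g : ∀ {t₀ t₁} → u₀ ⟶ t₀ → u₁ ⟶ t₁ → Outcome ◇ u₀ u₁ t₀ t₁ → X (select κ (u₀ , u₁) (t₀ , t₁))
      g s₀ s₁ o = (λ _ → f s₀ s₁ o) , contradiction refl
      flip : ∀ {t₀ t₁} → Outcome □ u₁ u₀ t₁ t₀ → Outcome ◇ u₀ u₁ t₀ t₁
      flip = [ inj₁ ∘ R-sym , inj₂ ∘ swap⊎ ]′
      byOwners : ∀ a b → 𝒫 u₀ ≡ a → 𝒫 u₁ ≡ b → Ctrl Duplicator (Ctrl Duplicator X) (move₁ κ (u₀ , u₁))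
      byOwners ◇ ◇ e₀ e₁ = moves {X = X} e₀ e₁
        ((λ ()) , λ _ t₀ s₀ →
          (λ _ → let t₁ , s₁ , o = outcome-SD r e₀ e₁ s₀ in t₁ , s₁ , g s₀ s₁ o) , contradiction refl)
      byOwners ◇ □ e₀ e₁ = moves {X = X} e₀ e₁
        ((λ ()) , λ _ t₀ s₀ → (λ ()) , λ _ t₁ s₁ → g s₀ s₁ (outcome-SS r e₀ e₁ s₀ s₁))
      byOwners □ ◇ e₀ e₁ = moves {X = X} e₀ e₁
        (let t₁ , s₁ , t₀ , s₀ , o = outcome-DD r e₀ e₁ in
         (λ _ → t₁ , s₁ , (λ _ → t₀ , s₀ , g s₀ s₁ o) , contradiction refl) , contradiction refl)
      byOwners □ □ e₀ e₁ = moves {X = X} e₀ e₁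
        ((λ ()) , λ _ t₁ s₁ →
          (λ _ → let t₀ , s₀ , o = outcome-SD (R-sym r) e₁ e₀ s₁ in t₀ , s₀ , g s₀ s₁ (flip o)) ,
          contradiction refl)

    -- The positional strategy of Duplicator and its correctness.

    Aim : Position → Pred Position 0ℓ
    Aim (start κ)      = Ctrl Duplicator (Ctrl Duplicator (Ctrl Duplicator (AtStart (Next κ))))
    Aim (move₁ κ _)    = Ctrl Duplicator (Ctrl Duplicator (AtStart (Next κ)))
    Aim (move₂ κ _ _)  = Ctrl Duplicator (AtStart (Next κ))
    Aim (select κ _ _) = AtStart (Next κ)

    Aim? : ∀ p → Decidable (Aim p)
    Aim? (start κ)      = Ctrl? ∃⇒? _ (Ctrl? ∃⇒? _ (Ctrl? ∃⇒? _ (AtStart? (Next? κ))))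
    Aim? (move₁ κ _)    = Ctrl? ∃⇒? _ (Ctrl? ∃⇒? _ (AtStart? (Next? κ)))
    Aim? (move₂ κ _ _)  = Ctrl? ∃⇒? _ (AtStart? (Next? κ))
    Aim? (select κ _ _) = AtStart? (Next? κ)

    Sound : Pred Position 0ℓ
    Sound p = Ctrl Duplicator (Aim p) p

    Good⇒Sound : ∀ {κ} → Good κ → Sound (start κ)
    Good⇒Sound good@(r , _) = (λ ()) , λ where
        _ _ keep → moves-Duplicator r (select-keep good)
        _ _ swap → swapped good
      where
      swapped : ∀ {v w c} → Good ((v , w) , c) → Aim (start ((v , w) , c)) (move₁ ((v , w) , c) (w , v))
      swapped {v} {w} good@(r , _) = case v Fin.≟ w of λ where
        (yes refl) → moves-Duplicator r (select-keep good)
        (no ne)    → moves-Duplicator (R-sym r) λ _ _ → select-swap ne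

    Aim⇒Sound : ∀ {p q} → p ⇒ q → Aim p q → Sound q
    Aim⇒Sound keep        a = a
    Aim⇒Sound swap        a = a
    Aim⇒Sound (choose₁ _) a = a
    Aim⇒Sound (choose₂ _) a = a
    Aim⇒Sound advance     a = Good⇒Sound (proj₁ a)
    Aim⇒Sound stay₀       a = Good⇒Sound (proj₁ a)
    Aim⇒Sound stay₁       a = Good⇒Sound (proj₁ a)

    aim : ∀ {p} → Dec (∃[ q ] (p ⇒ q × Aim p q)) → ∃ (p ⇒_)
    aim (yes (q , e , _)) = q , e
    aim (no _)            = ⇒-total _

    strategy : DuplicatorStrategy
    strategy _ p _ = aim (∃⇒? (Aim? p) p)

    strategy-aims : ∀ {p q} → Sound p → p ⇒ q →
                    (∀ d → q ≡ proj₁ (strategy [] p d)) → Aim p q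
    strategy-aims {p = p} {q} (own , other) e follows with toMove p ≟Con Duplicator
    ... | no ne = other ne q e
    ... | yes d = subst (Aim p) (sym (follows d)) (aimed (∃⇒? (Aim? p) p))
      where
      aimed : (a? : Dec (∃[ q ] (p ⇒ q × Aim p q))) → Aim p (proj₁ (aim a?))
      aimed (yes (_ , _ , a)) = a
      aimed (no ¬a)           = contradiction (own d) ¬a

    module _ {κ₀ : Configuration} (good : Good κ₀) (π : Play κ₀) (follows : Follows π strategy) where
      open Play π

      aimed : ∀ j → Sound (at j) → Aim (at j) (at (suc j))
      aimed j sound = strategy-aims sound (step j) (follows j)

      sound : ∀ j → Sound (at j)
      sound zero    = subst Sound (sym first) (Good⇒Sound good)
      sound (suc j) = Aim⇒Sound (step j) (aimed j (sound j))

      next : ∀ {j p} → at j ≡ p → ∃[ q ] (p ⇒ q × Aim p q × at (suc j) ≡ q)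
      next {j} refl = _ , step j , aimed j (sound j) , refl

      RewardFrom : ℕ → Set
      RewardFrom j = ∃[ k ] (j ≤ k × (∃[ vw ] at k ≡ start (vw , ✓)))

      later : ∀ {j} → RewardFrom (suc j) → RewardFrom j
      later (k , j<k , r) = k , ℕ.<⇒≤ j<k , r

      Descending : Configuration → Set
      Descending κ = Acc _≺_ (μ κ)

      -- Each unrewarded round consumes one layer of accessibility, at `select`; the other moves of
      -- the round pass it on.
      from-start  : ∀ {j κ} → Descending κ → at j ≡ start κ → RewardFrom j
      from-move₁  : ∀ {j κ u} → Descending κ → at j ≡ move₁ κ u → RewardFrom j
      from-move₂  : ∀ {j κ u t} → Descending κ → at j ≡ move₂ κ u t → RewardFrom j
      from-select : ∀ {j κ u t} → Descending κ → at j ≡ select κ u t → RewardFrom j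
      from-start a e with next e
      ... | _ , keep , _ , e′ = later (from-move₁ a e′)
      ... | _ , swap , _ , e′ = later (from-move₁ a e′)
      from-move₁ a e with next e
      ... | _ , choose₁ _ , _ , e′ = later (from-move₂ a e′)
      from-move₂ a e with next e
      ... | _ , choose₂ _ , _ , e′ = later (from-select a e′)
      from-select {j} (acc rs) e with next e
      ... | start (vw , c) , _ , (_ , inj₁ refl) , e′ = suc j , ℕ.n≤1+n j , vw , e′
      ... | start κ′       , _ , (_ , inj₂ lt)   , e′ = later (from-start (rs lt) e′)

      descending : ∀ κ → Descending κ
      descending κ = ×-wellFounded <-wellFounded <-wellFounded (μ κ)

      strategy-wins : WonByDuplicator π
      strategy-wins = record { priorities = priorities ; rewarded = rewarded }
        where
        priorities : ∀ j {v w c} → at j ≡ start ((v , w) , c) → Ω v ≡ Ω w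
        priorities zero e with trans (sym first) e
        ... | refl = priority (proj₁ good)
        priorities (suc j) e = priority (related (step j) (aimed j (sound j)) e)
          where
          related : ∀ {p q v w c} → p ⇒ q → Aim p q → q ≡ start ((v , w) , c) → R v w
          related advance a refl = proj₁ (proj₁ a)
          related stay₀   a refl = proj₁ (proj₁ a)
          related stay₁   a refl = proj₁ (proj₁ a)

        rewarded : ∀ m → RewardFrom m
        rewarded m with at m in e
        ... | start κ      = from-start (descending κ) e
        ... | move₁ κ _    = from-move₁ (descending κ) e
        ... | move₂ κ _ _  = from-move₂ (descending κ) e
        ... | select κ _ _ = from-select (descending κ) e

    R⇒DuplicatorWins : ∀ {v w} → R v w → DuplicatorWins v w
    R⇒DuplicatorWins {v} {w} r = strategy , strategy-wins {(v , w) , ✓} (r , _)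

theorem11 : (G : ParityGame) (v w : ParityGame.Vertex G) →
    Bisimulation.GovernedStutteringBisimilar G v w ⇔ BisimulationGame.DuplicatorWins G v w
theorem11 G v w = mk⇔
  (λ (R , gsb , r) →
     let S , S? , gsb′ , s = Bisimilarity.decidableGSB G R (λ _ → gsb) r
     in ToGame.R⇒DuplicatorWins G S? gsb′ s)
  (λ wins →
     let open FromGame G
         -- That `_~_` is a bisimulation is available only under its decidability, which
         -- `decidableGSB` may assume.
         S , _ , gsb , s = Bisimilarity.decidableGSB G _~_ ~-isGovernedStutteringBisimulation
                             (DuplicatorWins⇒~ wins)
     in S , gsb , s)
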